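{- Let $l\ge 2$, $k>l$ and $m\ge 2$ be integers with $2k\neq ml$. Then, as $n\to\infty$, $$ex(n,C_{ml},\{C_3,C_4,\dots,C_{2l-1}\}\cup\{C_{2k}\})=\Theta(n^m).$$
   Context: $C_k$ denotes the cycle with $k$ vertices. For a graph $H$ and a family of graphs $\mathcal F$, $ex(n,H,\mathcal F)$ is the maximum number of subgraphs isomorphic to $H$ in an $n$-vertex graph containing no member of $\mathcal F$ as a subgraph. -}

module Defs where

open import Data.Bool.Base using (true; false)
open import Data.Fin.Base using (Fin; toℕ)
open import Data.Fin.Properties as Fin using (all?; any?)
open import Data.Fin.Subset using (Subset; _∈_)
open import Data.Fin.Subset.Properties using (_∈?_)
open import Data.List.Base as List using (List; []; _∷_)
import Data.List.Extrema.Nat as Extrema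
open import Data.List.Relation.Unary.All as All using (All)
open import Data.Maybe.Base as Maybe using ()
open import Data.Nat.Base using (ℕ; zero; suc; _+_; _*_; _∸_; _≤_)
import Data.Nat.Properties as ℕ
open import Data.Product using (Σ; ∃; ∃₂; _×_; _,_)
open import Data.Sum.Base using (_⊎_; swap)
open import Data.Vec.Base using (Vec; []; _∷_; lookup; tabulate)
open import Data.Vec.Properties using (lookup∘tabulate; lookup⇒[]=; []=⇒lookup)
open import Function.Base using (_∘_)
open import Level using (Level; 0ℓ)
open import Relation.Binary.Core using (Rel)
import Relation.Binary.Definitions as B
open import Relation.Binary.PropositionalEquality
  using (_≡_; _≢_; refl; sym; trans; cong)
open import Relation.Nullary.Decidable
  using (Dec; yes; no; does; map′; ¬?; _×-dec_; _⊎-dec_; _→-dec_; dec⇒maybe)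
open import Relation.Nullary.Negation using (¬_; contradiction)
open import Relation.Unary using (Pred; Decidable)

private
  variable
    ℓ : Level
    A : Set
    h n : ℕ

------------------------------------------------------------------------
-- Exhaustive search over vectors

vectors : List A → (k : ℕ) → List (Vec A k)
vectors xs zero    = [] ∷ []
vectors xs (suc k) = List.cartesianProductWith _∷_ xs (vectors xs k)

anyVec? : ∀ {k} {P : Pred (Vec (Fin n) k) ℓ} → Decidable P → Dec (∃ P)
anyVec? {k = zero}  P? = map′ ([] ,_) (λ { ([] , p) → p }) (P? [])
anyVec? {k = suc k} P? =
  map′ (λ (x , xs , p) → x ∷ xs , p) (λ { (x ∷ xs , p) → x , xs , p })
       (any? λ x → anyVec? λ xs → P? (x ∷ xs))

------------------------------------------------------------------------
-- Finite simple graphs on the vertex set Fin n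

Neighbourhoods : ℕ → Set
Neighbourhoods n = Vec (Subset n) n

Simple : Neighbourhoods n → Set
Simple N = (∀ i → ¬ (i ∈ lookup N i))
         × (∀ i j → j ∈ lookup N i → i ∈ lookup N j)

simple? : Decidable (Simple {n})
simple? N = all? (λ i → ¬? (i ∈? lookup N i))
      ×-dec all? (λ i → all? λ j → (j ∈? lookup N i) →-dec (i ∈? lookup N j))

-- The proof of simplicity is irrelevant, so that two graphs are
-- propositionally equal exactly when their edge sets agree; it can be
-- recovered by recomputing it with simple?.

record Graph (n : ℕ) : Set where
  constructor mkGraph
  field
    neighbours : Neighbourhoods n
    .simple    : Simple neighbours

  Adj : Rel (Fin n) 0ℓ
  Adj i j = j ∈ lookup neighbours i

  adj? : B.Decidable Adj
  adj? i j = j ∈? lookup neighbours i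

open Graph public

-- Every graph on Fin n occurs exactly once.

graphs : (n : ℕ) → List (Graph n)
graphs n = List.mapMaybe
  (λ N → Maybe.map (λ s → mkGraph N s) (dec⇒maybe (simple? N)))
  (vectors (vectors (true ∷ false ∷ []) n) n)

module _ {R : Rel (Fin n) 0ℓ} (R? : B.Decidable R)
         (R-irrefl : ∀ i → ¬ R i i) (R-sym : ∀ i j → R i j → R j i) where

  private
    N : Neighbourhoods n
    N = tabulate λ i → tabulate λ j → does (R? i j)

    entry : ∀ i j → lookup (lookup N i) j ≡ does (R? i j)
    entry i j = trans
      (cong (λ v → lookup v j) (lookup∘tabulate (λ i → tabulate λ j → does (R? i j)) i))
      (lookup∘tabulate (λ j → does (R? i j)) j)

    to : ∀ i j → R i j → j ∈ lookup N i
    to i j r with R? i j | entry i j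
    ... | yes _ | e = lookup⇒[]= j _ e
    ... | no ¬r | _ = contradiction r ¬r

    from : ∀ i j → j ∈ lookup N i → R i j
    from i j j∈Ni with R? i j | trans (sym (entry i j)) ([]=⇒lookup j∈Ni)
    ... | yes r | _ = r

  fromRel : Graph n
  fromRel = mkGraph N
    ( (λ i → R-irrefl i ∘ from i i)
    , (λ i j → to j i ∘ R-sym i j ∘ from i j))

------------------------------------------------------------------------
-- Cycles

Next : Rel (Fin n) 0ℓ
Next {n} i j = (suc (toℕ i) ≡ toℕ j) ⊎ (suc (toℕ i) ≡ n × toℕ j ≡ 0)

next? : B.Decidable (Next {n})
next? {n} i j = (suc (toℕ i) ℕ.≟ toℕ j)
          ⊎-dec ((suc (toℕ i) ℕ.≟ n) ×-dec (toℕ j ℕ.≟ 0))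

-- This is the k-cycle for k ≥ 3.  The condition i ≢ j only matters for
-- k = 1, where it excludes a loop.

C : (k : ℕ) → Graph k
C k = fromRel {R = λ i j → i ≢ j × (Next i j ⊎ Next j i)}
  (λ i j → ¬? (i Fin.≟ j) ×-dec (next? i j ⊎-dec next? j i))
  (λ i (i≢i , _) → i≢i refl)
  (λ i j (i≢j , e) → i≢j ∘ sym , swap e)

------------------------------------------------------------------------
-- Subgraphs

Injective : Vec (Fin n) h → Set
Injective φ = ∀ i j → lookup φ i ≡ lookup φ j → i ≡ j

injective? : Decidable (Injective {n} {h})
injective? φ = all? λ i → all? λ j →
  (lookup φ i Fin.≟ lookup φ j) →-dec (i Fin.≟ j)

-- A subgraph candidate: a vertex set together with an edge set.

Sub : ℕ → Set
Sub n = Subset n × Graph n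

subs : (n : ℕ) → List (Sub n)
subs n = List.cartesianProduct (vectors (true ∷ false ∷ []) n) (graphs n)

IsSubgraphOf : Graph n → Sub n → Set
IsSubgraphOf G (V , E) =
  ∀ i j → Adj E i j → Adj G i j × i ∈ V × j ∈ V

isSubgraphOf? : (G : Graph n) → Decidable (IsSubgraphOf G)
isSubgraphOf? G (V , E) = all? λ i → all? λ j →
  adj? E i j →-dec (adj? G i j ×-dec ((i ∈? V) ×-dec (j ∈? V)))

-- Maps out of Fin h are represented by the vector of their values.

IsIso : Graph h → Sub n → Vec (Fin n) h → Set
IsIso H (V , E) φ =
    Injective φ
  × (∀ i → lookup φ i ∈ V)
  × (∀ v → v ∈ V → ∃ λ i → lookup φ i ≡ v)
  × (∀ i j → Adj H i j → Adj E (lookup φ i) (lookup φ j))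
  × (∀ i j → Adj E (lookup φ i) (lookup φ j) → Adj H i j)

isIso? : (H : Graph h) (S : Sub n) → Decidable (IsIso H S)
isIso? H (V , E) φ =
        injective? φ
  ×-dec all? (λ i → lookup φ i ∈? V)
  ×-dec all? (λ v → (v ∈? V) →-dec any? λ i → lookup φ i Fin.≟ v)
  ×-dec all? (λ i → all? λ j → adj? H i j →-dec adj? E (lookup φ i) (lookup φ j))
  ×-dec all? (λ i → all? λ j → adj? E (lookup φ i) (lookup φ j) →-dec adj? H i j)

IsCopy : Graph h → Graph n → Sub n → Set
IsCopy H G S = IsSubgraphOf G S × ∃ (IsIso H S)

isCopy? : (H : Graph h) (G : Graph n) → Decidable (IsCopy H G)
isCopy? H G S = isSubgraphOf? G S ×-dec anyVec? (isIso? H S)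

#copies : Graph h → Graph n → ℕ
#copies {n = n} H G = List.length (List.filter (isCopy? H G) (subs n))

------------------------------------------------------------------------
-- Generalized Turán numbers

-- G has a (not necessarily induced) subgraph isomorphic to H.

Contains : Graph n → Graph h → Set
Contains {n} {h} G H = Σ (Vec (Fin n) h) λ φ →
  Injective φ × (∀ i j → Adj H i j → Adj G (lookup φ i) (lookup φ j))

contains? : (G : Graph n) (H : Graph h) → Dec (Contains G H)
contains? G H = anyVec? λ φ → injective? φ ×-dec
  all? λ i → all? λ j → adj? H i j →-dec adj? G (lookup φ i) (lookup φ j)

Free : List (∃ Graph) → Graph n → Set
Free F G = All (λ (_ , H) → ¬ Contains G H) F

free? : (F : List (∃ Graph)) → Decidable (Free {n} F)
free? F G = All.all? (λ (_ , H) → ¬? (contains? G H)) F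

-- The value is 0 if no graph on n vertices is F-free.

ex : (n : ℕ) → Graph h → List (∃ Graph) → ℕ
ex n H F = Extrema.max 0 (List.map (#copies H) (List.filter (free? F) (graphs n)))

-- C a, C (a + 1), …, C b.

cycles : (a b : ℕ) → List (∃ Graph)
cycles a b = List.applyUpTo (λ i → a + i , C (a + i)) (suc b ∸ a)

------------------------------------------------------------------------
-- Asymptotics of functions ℕ → ℕ

-- A natural-number constant loses nothing: a real one can be rounded up.

infix 4 _=O_ _=Θ_

_=O_ : Rel (ℕ → ℕ) 0ℓ
f =O g = ∃₂ λ c n₀ → ∀ n → n₀ ≤ n → f n ≤ c * g n

_=Θ_ : Rel (ℕ → ℕ) 0ℓ
f =Θ g = f =O g × g =O f

{-# OPTIONS --safe #-}

-- Upper bound.  If the girth is at least 2l, a path of length l ∸ 1 is determined by its ends, and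
-- distinct paths of length l with the same ends are internally disjoint.  To bound a family of
-- paths or cycles, give each member finitely many labels and greedily remove the labels borne by
-- few members: either the family is at most a constant times the number of labels, or a nonempty
-- subfamily remains in which each label that occurs occurs often.  In the latter case pieces can
-- be exchanged while avoiding any given small set, and some path of length l gets a disjoint
-- companion of length l + 2(k ∸ l) with the same ends, which makes a C₂ₖ.  For the paths of
-- length l into a fixed vertex the labels are the first and the second vertex, so there are O(n)
-- such paths.  For the rooted cycles of length ml the labels are, for each rotation, the
-- complement of the first segment of length l; it is a chain of m ∸ 1 paths of length l, so there
-- are O(n · nᵐ⁻¹) labels.
--
-- Lower bound.  Put m hubs on a circle and join consecutive hubs by t = ⌊n / ml⌋ disjoint paths
-- of length l.  A cycle that always runs in the same direction has length ml; one that turns can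
-- do so only at a hub, and then both of its branches reach the same next hub, so its length is 2l.
-- The cycles of the first kind number tᵐ.

module Submission where

open import Defs
open import Data.Bool.Base using (true; false)
open import Data.Empty using (⊥; ⊥-elim)
open import Data.Fin.Base as Fin using (Fin; zero; suc; toℕ)
import Data.Fin.Properties as Fin
open import Data.Fin.Subset as Subset using (Subset)
import Data.Fin.Subset.Properties as Subset
open import Data.List.Base as List
  using ( List; []; _∷_; _++_; [_]; length; filter; map; reverse; drop; take; upTo; allFin
        ; concatMap; cartesianProduct; cartesianProductWith)
import Data.List.Extrema.Nat as Extrema
open import Data.List.Membership.Propositional using (_∈_; _∉_; find; lose)
open import Data.List.Membership.Propositional.Properties
  using ( ∈-applyUpTo⁺; ∈-applyUpTo⁻; ∈-allFin; ∈-cartesianProduct⁺; ∈-cartesianProductWith⁺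
        ; ∈-concatMap⁺; ∈-upTo⁺; ∈-++⁺ˡ; ∈-++⁺ʳ; ∈-++⁻; ∈-∃++; ∈-filter⁺; ∈-filter⁻
        ; ∈-map⁺; ∈-map⁻)
import Data.List.Properties as List
open import Data.List.Relation.Binary.Disjoint.Propositional using (Disjoint)
open import Data.List.Relation.Binary.Permutation.Propositional
  using (_↭_; ↭⇒↭ₛ; ↭-sym; ↭-trans; prep)
import Data.List.Relation.Binary.Permutation.Propositional.Properties as Perm
import Data.List.Relation.Binary.Permutation.Setoid.Properties as PermSetoid
open import Data.List.Relation.Binary.Subset.Propositional using (_⊆_)
open import Data.List.Relation.Unary.All as All using (All; []; _∷_)
open import Data.List.Relation.Unary.AllPairs using ([]; _∷_)
open import Data.List.Relation.Unary.Any as Any using (here; there)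
import Data.List.Relation.Unary.Unique.DecPropositional as UniqueDec
open import Data.List.Relation.Unary.Unique.Propositional using (Unique)
import Data.List.Relation.Unary.Unique.Propositional.Properties as Unique
open import Data.Maybe.Base as Maybe using (Maybe; just; nothing)
open import Data.Nat.Base
  using ( ℕ; zero; suc; _+_; _*_; _∸_; _^_; _≤_; _<_; z≤n; s≤s; s≤s⁻¹
        ; NonZero; >-nonZero⁻¹; ≢-nonZero⁻¹; >-nonZero)
open import Data.Nat.Divisibility
  using ( _∣_; _∣?_; divides; ∣⇒≤; ∣-antisym; ∣-refl; ∣m+n∣m⇒∣n; ∣m∣n⇒∣m+n; _∣0; n∣m*n
        ; m%n≡0⇒n∣m; ∣n∣m%n⇒∣m; %-presˡ-∣)
open import Data.Nat.DivMod
  using ( _/_; _%_; _mod_; %-distribˡ-+; %-distribˡ-*; [m+kn]%n≡m%n; [m+n]%n≡m%n; m*n%n≡0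
        ; m<n⇒m%n≡m; m%n%n≡m%n; m%n<n; n%n≡0; +-distrib-/-∣ʳ; m<n⇒m/n≡0; m*n/n≡m
        ; m≡m%n+[m/n]*n; m/n*n≤m; m<n*o⇒m/o<n; m≥n⇒m/n>0)
import Data.Nat.Properties as ℕ
open import Data.Nat.Solver using (module +-*-Solver)
open +-*-Solver using (solve; con; _:+_; _:*_; _:=_)
open import Data.Product using (∃; ∃₂; _×_; _,_; proj₁; proj₂)
open import Data.Sum.Base as Sum using (_⊎_; inj₁; inj₂; [_,_]′)
open import Data.Unit.Base using (⊤; tt)
open import Data.Vec.Base as Vec using (Vec; []; _∷_)
import Data.Vec.Properties as Vec
import Data.Vec.Relation.Unary.All.Properties as VecAll
open import Data.Vec.Relation.Unary.AllPairs using ([]; _∷_)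
import Data.Vec.Relation.Unary.Unique.Propositional as VecUnique
import Data.Vec.Relation.Unary.Unique.Propositional.Properties as VecUnique
open import Function.Base using (_∘_; id)
open import Level using (0ℓ)
open import Relation.Binary.Core using (Rel)
import Relation.Binary.Definitions as B
open import Relation.Binary.PropositionalEquality
  using (_≡_; _≢_; refl; sym; trans; cong; cong₂; subst; subst₂; setoid)
open import Relation.Nullary.Decidable
  using (Dec; yes; no; does; ¬?; _×-dec_; _⊎-dec_; _→-dec_; dec⇒maybe; recompute)
open import Relation.Nullary.Negation using (¬_; contradiction)

private
  variable
    A X Y K : Set
    n k : ℕ

-- Counting in lists without repetition

length-filter-split : {P : A → Set} (P? : ∀ x → Dec (P x)) (xs : List A) →
  length xs ≡ length (filter P? xs) + length (filter (¬? ∘ P?) xs)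
length-filter-split P? [] = refl
length-filter-split P? (x ∷ xs) with P? x
... | yes _ = cong suc (length-filter-split P? xs)
... | no  _ = trans (cong suc (length-filter-split P? xs)) (sym (ℕ.+-suc _ _))

Unique-length≤1 : {xs : List A} → Unique xs →
  (∀ {x y} → x ∈ xs → y ∈ xs → x ≡ y) → length xs ≤ 1
Unique-length≤1 [] _ = z≤n
Unique-length≤1 ([] ∷ []) _ = s≤s z≤n
Unique-length≤1 ((x≢y ∷ _) ∷ _) eq = contradiction (eq (here refl) (there (here refl))) x≢y

Unique-⊆⇒length≤ : {xs ys : List A} → Unique xs → xs ⊆ ys → length xs ≤ length ys
Unique-⊆⇒length≤ [] _ = z≤n
Unique-⊆⇒length≤ {xs = x ∷ xs} (x∉xs ∷ u) xs⊆ys with ∈-∃++ (xs⊆ys (here refl))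
... | ps , qs , refl = ℕ.≤-trans (s≤s (Unique-⊆⇒length≤ u rest))
    (ℕ.≤-reflexive (sym (Perm.↭-length (Perm.shift x ps qs))))
  where
  rest : xs ⊆ ps ++ qs
  rest {y} y∈xs with Perm.∈-resp-↭ (Perm.shift x ps qs) (xs⊆ys (there y∈xs))
  ... | here refl = contradiction refl (All.lookup x∉xs y∈xs)
  ... | there y∈  = y∈

Unique-map⁺ : (f : X → Y) {xs : List X} → Unique xs →
  (∀ {x y} → x ∈ xs → y ∈ xs → f x ≡ f y → x ≡ y) → Unique (map f xs)
Unique-map⁺ f [] _ = []
Unique-map⁺ f (x∉xs ∷ u) inj = All.tabulate
    (λ {z} z∈ eq → let (y , y∈ , z≡fy) = ∈-map⁻ f z∈ in
      All.lookup x∉xs y∈ (inj (here refl) (there y∈) (trans eq z≡fy)))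
  ∷ Unique-map⁺ f u (λ x∈ y∈ → inj (there x∈) (there y∈))

-- Pigeonhole: each member of `F` spoils at most one member of `xs`. Discarding what `f` spoils
-- shortens `xs` by at most one, so the strict inequality survives the induction on `F`.
∃-avoiding : {Hit : X → Y → Set} (hit? : ∀ x y → Dec (Hit x y)) (F : List Y) (xs : List X) →
  Unique xs → (∀ {x x′ f} → x ∈ xs → x′ ∈ xs → Hit x f → Hit x′ f → x ≡ x′) →
  length F < length xs → ∃ λ x → x ∈ xs × (∀ {f} → f ∈ F → ¬ Hit x f)
∃-avoiding hit? [] (x ∷ xs) _ _ _ = x , here refl , λ ()
∃-avoiding {Hit = Hit} hit? (f ∷ F) xs u once F<xs
  with ∃-avoiding {Hit = Hit} hit? F miss (Unique.filter⁺ (¬? ∘ P?) u)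
         (λ x∈ y∈ → once (proj₁ (∈-filter⁻ (¬? ∘ P?) x∈)) (proj₁ (∈-filter⁻ (¬? ∘ P?) y∈)))
         (s≤s⁻¹ (ℕ.≤-trans F<xs (ℕ.≤-trans (ℕ.≤-reflexive (length-filter-split P? xs))
           (ℕ.+-monoˡ-≤ _ hits≤1))))
  where
  P? = λ x → hit? x f
  miss = filter (¬? ∘ P?) xs
  hits≤1 : length (filter P? xs) ≤ 1
  hits≤1 = Unique-length≤1 (Unique.filter⁺ P? u) λ x∈ y∈ →
    let (x∈xs , hx) = ∈-filter⁻ P? x∈ ; (y∈xs , hy) = ∈-filter⁻ P? y∈ in once x∈xs y∈xs hx hy
... | x , x∈ , avoids = x , proj₁ (∈-filter⁻ (¬? ∘ λ x → hit? x f) {xs = xs} x∈) , λ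
  { (here refl) → proj₂ (∈-filter⁻ (¬? ∘ λ x → hit? x f) {xs = xs} x∈) ; (there f∈) → avoids f∈ }

-- Labels met by at most c items are removed greedily, together with these items.
peel : {R : X → K → Set} (R? : ∀ x k → Dec (R x k)) (c : ℕ) (ks : List K) (xs : List X) →
  Unique xs →
  length xs ≤ length ks * c ⊎
  ∃ λ S → S ⊆ xs × Unique S × (∃ λ x → x ∈ S) ×
    (∀ {x k} → x ∈ S → k ∈ ks → R x k → c < length (filter (λ y → R? y k) S))
peel {X = X} {K = K} {R = R} R? c ks xs u = go (length ks) ks xs refl u
  where
  Rich : List K → List X → List X → Set
  Rich ks xs S = S ⊆ xs × Unique S × (∃ λ x → x ∈ S) ×
    (∀ {x k} → x ∈ S → k ∈ ks → R x k → c < length (filter (λ y → R? y k) S))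

  go : ∀ n ks xs → length ks ≡ n → Unique xs → length xs ≤ n * c ⊎ ∃ (Rich ks xs)
  go n ks xs len u with Any.any? (λ k → length (filter (λ y → R? y k) xs) ℕ.≤? c) ks
  go n ks [] len u | no _ = inj₁ z≤n
  go n ks (x ∷ xs) len u | no ¬poor = inj₂ (x ∷ xs , id , u , (x , here refl) ,
    λ _ k∈ks _ → ℕ.≰⇒> λ le → ¬poor (lose k∈ks le))
  go n ks xs len u | yes p with find p
  ... | k , k∈ks , few with ∈-∃++ k∈ks
  go zero .(as ++ k ∷ bs) xs len u | yes p | k , k∈ks , few | as , bs , refl =
    contradiction (trans (sym (Perm.↭-length (Perm.shift k as bs))) len) λ ()
  go (suc n) .(as ++ k ∷ bs) xs len u | yes p | k , k∈ks , few | as , bs , refl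
    with go n (as ++ bs) (filter (¬? ∘ λ y → R? y k) xs)
           (ℕ.suc-injective (trans (sym (Perm.↭-length (Perm.shift k as bs))) len))
           (Unique.filter⁺ _ u)
  ... | inj₁ le = inj₁ (ℕ.≤-trans (ℕ.≤-reflexive (length-filter-split (λ y → R? y k) xs))
          (ℕ.+-mono-≤ few le))
  ... | inj₂ (S , S⊆ , uS , ne , rich) = inj₂
    (S , (proj₁ ∘ ∈-filter⁻ (¬? ∘ λ y → R? y k) {xs = xs} ∘ S⊆) , uS , ne , rich′)
    where
    rich′ : ∀ {x k′} → x ∈ S → k′ ∈ as ++ k ∷ bs → R x k′ →
      c < length (filter (λ y → R? y k′) S)
    rich′ x∈S k′∈ r with Perm.∈-resp-↭ (Perm.shift k as bs) k′∈
    -- The removed label `k` imposes nothing: its bearers left together with it, so no member of `S`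
    -- bears it.
    ... | here refl = contradiction r (proj₂ (∈-filter⁻ (¬? ∘ λ y → R? y k) {xs = xs} (S⊆ x∈S)))
    ... | there k′∈ = rich x∈S k′∈ r

-- Walks, paths and cycles

Unique-resp-↭ : {xs ys : List A} → xs ↭ ys → Unique xs → Unique ys
Unique-resp-↭ p = PermSetoid.Unique-resp-↭ (setoid _) (↭⇒↭ₛ p)

Unique-++⁻ : (xs : List A) {ys : List A} → Unique (xs ++ ys) →
  Unique xs × Unique ys × Disjoint xs ys
Unique-++⁻ [] u = [] , u , λ ()
Unique-++⁻ (x ∷ xs) (x∉ ∷ u) with Unique-++⁻ xs u
... | uxs , uys , dis =
  All.tabulate (λ y∈ → All.lookup x∉ (∈-++⁺ˡ y∈)) ∷ uxs , uys , λ
    { (here refl , v∈ys) → All.lookup x∉ (∈-++⁺ʳ xs v∈ys) refl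
    ; (there v∈xs , v∈ys) → dis (v∈xs , v∈ys) }

∉-head : {x : A} {xs : List A} → Unique (x ∷ xs) → x ∉ xs
∉-head (x∉ ∷ _) x∈ = All.lookup x∉ x∈ refl

Unique-∷⁺ : {x : A} {xs : List A} → x ∉ xs → Unique xs → Unique (x ∷ xs)
Unique-∷⁺ x∉ u = All.tabulate (λ y∈ eq → x∉ (subst (_∈ _) (sym eq) y∈)) ∷ u

module Walks {V : Set} (_≟_ : B.DecidableEquality V) {_~_ : V → V → Set}
  (~-sym : ∀ {a b} → a ~ b → b ~ a) where

  -- The list holds the internal vertices.
  Walk : V → List V → V → Set
  Walk a []      b = a ~ b
  Walk a (x ∷ p) b = a ~ x × Walk x p b

  Path : V → List V → V → Set
  Path a p b = Walk a p b × Unique (a ∷ p ++ [ b ])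

  IsCycle : List V → Set
  IsCycle []      = ⊥
  IsCycle (a ∷ p) = Walk a p a × Unique (a ∷ p)

  walk-++ : ∀ {a b c} p {q} → Walk a p b → Walk b q c → Walk a (p ++ b ∷ q) c
  walk-++ []      e        w′ = e , w′
  walk-++ (x ∷ p) (e , w) w′ = e , walk-++ p w w′

  walk-split : ∀ {a b c} p {q} → Walk a (p ++ b ∷ q) c → Walk a p b × Walk b q c
  walk-split []      (e , w) = e , w
  walk-split (x ∷ p) (e , w) with walk-split p w
  ... | w₁ , w₂ = (e , w₁) , w₂

  walk-reverse : ∀ {a b} p → Walk a p b → Walk b (reverse p) a
  walk-reverse [] e = ~-sym e
  walk-reverse {a} {b} (x ∷ p) (e , w) = subst (λ r → Walk b r a) (sym (List.unfold-reverse x p))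
    (walk-++ (reverse p) (walk-reverse p w) (~-sym e))

  path-split : ∀ {a b v} p {q} → Path a (p ++ v ∷ q) b → Path a p v × Path v q b
  path-split {a} {b} {v} p {q} (w , u) =
    (proj₁ ww , proj₁ (Unique-++⁻ (a ∷ p ++ [ v ]) (subst Unique eq₁ u))) ,
    (proj₂ ww , proj₁ (proj₂ (Unique-++⁻ (a ∷ p) (subst Unique eq₂ u))))
    where
    ww = walk-split p w
    eq₂ : a ∷ (p ++ v ∷ q) ++ [ b ] ≡ (a ∷ p) ++ v ∷ (q ++ [ b ])
    eq₂ = cong (a ∷_) (List.++-assoc p (v ∷ q) [ b ])
    eq₁ : a ∷ (p ++ v ∷ q) ++ [ b ] ≡ (a ∷ p ++ [ v ]) ++ q ++ [ b ]
    eq₁ = trans eq₂ (cong (a ∷_) (sym (List.++-assoc p [ v ] (q ++ [ b ]))))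

  path-interior : ∀ {a b p} → Path a p b → a ∉ p × b ∉ p × a ≢ b × Unique p
  path-interior {a} {b} {p} (_ , u@(_ ∷ u′)) =
    let (up , _ , dis) = Unique-++⁻ p u′ in
    ∉-head u ∘ ∈-++⁺ˡ , (λ b∈p → dis (b∈p , here refl)) ,
    (λ { refl → ∉-head u (∈-++⁺ʳ p (here refl)) }) , up

  mkPath : ∀ {a b p} → Walk a p b → a ≢ b → a ∉ p → b ∉ p → Unique p → Path a p b
  mkPath {a} {b} {p} w a≢b a∉p b∉p up = w , Unique-∷⁺ a∉ (Unique.++⁺ up ([] ∷ []) dis)
    where
    a∉ : a ∉ p ++ [ b ]
    a∉ a∈ with ∈-++⁻ p a∈
    ... | inj₁ a∈p = a∉p a∈p
    ... | inj₂ (here a≡b) = a≢b a≡b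
    dis : Disjoint p [ b ]
    dis (v∈p , here refl) = b∉p v∈p

  paths⇒cycle : ∀ {a b} p q → Path a p b → Path a q b → Disjoint p q →
    IsCycle (a ∷ p ++ b ∷ reverse q)
  paths⇒cycle {a} {b} p q P@(wp , up) Q@(wq , uq) dis =
    walk-++ p wp (walk-reverse q wq) ,
    Unique.++⁺ (proj₁ (Unique-++⁻ (a ∷ p) up))
      (Unique-resp-↭ (↭-sym (↭-trans (prep b (Perm.↭-reverse q)) (Perm.∷↭∷ʳ b q))) (proj₁ (proj₂ (Unique-++⁻ [ a ] uq))))
      λ { (here refl , here refl) → proj₁ (proj₂ (proj₂ (path-interior P))) refl
        ; (here refl , there v∈) → proj₁ (path-interior Q) (Perm.∈-resp-↭ (Perm.↭-reverse q) v∈)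
        ; (there v∈ , here refl) → proj₁ (proj₂ (path-interior P)) v∈
        ; (there v∈p , there v∈q) → dis (v∈p , Perm.∈-resp-↭ (Perm.↭-reverse q) v∈q) }

  length-paths⇒cycle : ∀ (a b : V) p q →
    length (a ∷ p ++ b ∷ reverse q) ≡ 2 + (length p + length q)
  length-paths⇒cycle a b p q = cong suc (trans (List.length-++ p)
    (trans (ℕ.+-suc _ _) (cong (λ n → suc (length p + n)) (List.length-reverse q))))

  cycle-rotate : ∀ p q → IsCycle (p ++ q) → IsCycle (q ++ p)
  cycle-rotate [] q cyc = subst IsCycle (sym (List.++-identityʳ q)) cyc
  cycle-rotate (x ∷ p) [] cyc = subst IsCycle (List.++-identityʳ (x ∷ p)) cyc
  cycle-rotate (x ∷ p) (y ∷ q) (w , u) with walk-split p w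
  ... | w₁ , w₂ = walk-++ q w₂ w₁ , Unique-resp-↭ (Perm.++-comm (x ∷ p) (y ∷ q)) u

  cycle⇒path : ∀ {a b} s {t} → IsCycle (a ∷ s ++ b ∷ t) → Path a s b
  cycle⇒path {a} {b} s {t} (w , u) = proj₁ (walk-split s w) ,
    proj₁ (Unique-++⁻ (a ∷ s ++ [ b ]) (subst (λ r → Unique (a ∷ r)) (sym (List.++-assoc s [ b ] t)) u))

  -- p₁ leads from the start of p to a vertex c on p or to the end b of p.
  Prefix : List V → V → List V → V → Set
  Prefix p b p₁ c = (p ≡ p₁ × b ≡ c) ⊎ (∃ λ p₂ → p ≡ p₁ ++ c ∷ p₂)

  prefix-∷ : ∀ {p b p₁ c} x → Prefix p b p₁ c → Prefix (x ∷ p) b (x ∷ p₁) c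
  prefix-∷ x (inj₁ (refl , refl)) = inj₁ (refl , refl)
  prefix-∷ x (inj₂ (p₂ , refl))   = inj₂ (p₂ , refl)

  prefix-path : ∀ {a b c p p₁} → Prefix p b p₁ c → Path a p b → Path a p₁ c
  prefix-path (inj₁ (refl , refl)) P = P
  prefix-path {p₁ = p₁} (inj₂ (p₂ , refl)) P = proj₁ (path-split p₁ P)

  prefix-⊆ : ∀ {b c p p₁} → Prefix p b p₁ c → p₁ ⊆ p
  prefix-⊆ (inj₁ (refl , _)) = id
  prefix-⊆ (inj₂ (_ , refl)) = ∈-++⁺ˡ

  prefix-length : ∀ {b c p p₁} → Prefix p b p₁ c → length p₁ ≤ length p
  prefix-length (inj₁ (refl , _)) = ℕ.≤-refl
  prefix-length {p₁ = p₁} (inj₂ (_ , refl)) =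
    ℕ.≤-trans (ℕ.m≤m+n _ _) (ℕ.≤-reflexive (sym (List.length-++ p₁)))

  ∈⇒prefix : ∀ {b c} p → c ∈ p ++ [ b ] → ∃ λ p₁ → Prefix p b p₁ c
  ∈⇒prefix [] (here refl) = [] , inj₁ (refl , refl)
  ∈⇒prefix (x ∷ p) (here refl) = [] , inj₂ (p , refl)
  ∈⇒prefix (x ∷ p) (there c∈) with ∈⇒prefix p c∈
  ... | p₁ , pre = x ∷ p₁ , prefix-∷ x pre

  _∈?_ : ∀ x (xs : List V) → Dec (x ∈ xs)
  x ∈? xs = Any.any? (x ≟_) xs

  firstMeeting : ∀ {b} p Q → b ∈ Q → ∃₂ λ p₁ c → Prefix p b p₁ c × c ∈ Q × Disjoint p₁ Q
  firstMeeting {b} [] Q b∈Q = [] , b , inj₁ (refl , refl) , b∈Q , λ ()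
  firstMeeting (x ∷ p) Q b∈Q with x ∈? Q
  ... | yes x∈Q = [] , x , inj₂ (p , refl) , x∈Q , λ ()
  ... | no x∉Q with firstMeeting p Q b∈Q
  ...   | p₁ , c , pre , c∈Q , dis = x ∷ p₁ , c , prefix-∷ x pre , c∈Q , λ
    { (here refl , v∈Q) → x∉Q v∈Q ; (there v∈ , v∈Q) → dis (v∈ , v∈Q) }

  -- An edge run back and forth satisfies `IsCycle` with two vertices, hence the lower bound 3.
  GirthAtLeast : ℕ → Set
  GirthAtLeast g = ∀ xs → IsCycle xs → 3 ≤ length xs → length xs < g → ⊥

  NoCycleOfLength : ℕ → Set
  NoCycleOfLength k = ∀ xs → IsCycle xs → length xs ≢ k

  -- Short paths in a graph of large girth

  module Girth {g : ℕ} (girth : GirthAtLeast g) where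

    -- Cut `p` at its first vertex `c` on `q` (possibly the common end `b`) and cut `q` at `c` as
    -- well: the two pieces are internally disjoint and close up to a cycle that is too short. The
    -- third hypothesis says that the paths do not begin with the same edge, the case in which this
    -- cycle would degenerate to that edge.
    fork : ∀ {a b} p q → Path a p b → Path a q b →
      (∀ {c} → Prefix p b [] c → Prefix q b [] c → ⊥) →
      2 + (length p + length q) < g → ⊥
    fork {a} {b} p q P Q apart short with firstMeeting {b} p (q ++ [ b ]) (∈-++⁺ʳ q (here refl))
    ... | p₁ , c , pre-p , c∈ , dis with ∈⇒prefix q c∈
    ... | q₁ , pre-q = girth (a ∷ p₁ ++ c ∷ reverse q₁)
        (paths⇒cycle p₁ q₁ (prefix-path pre-p P) (prefix-path pre-q Q)
          λ (v∈p₁ , v∈q₁) → dis (v∈p₁ , ∈-++⁺ˡ (prefix-⊆ pre-q v∈q₁)))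
        (subst (3 ≤_) (sym len) (long p₁ q₁ pre-p pre-q))
        (subst (_< g) (sym len) (ℕ.≤-<-trans
          (s≤s (s≤s (ℕ.+-mono-≤ (prefix-length pre-p) (prefix-length pre-q)))) short))
      where
      len = length-paths⇒cycle a c p₁ q₁
      long : ∀ p₁ q₁ → Prefix p b p₁ c → Prefix q b q₁ c → 3 ≤ 2 + (length p₁ + length q₁)
      long []      []      x y = ⊥-elim (apart x y)
      long []      (_ ∷ _) _ _ = s≤s (s≤s (s≤s z≤n))
      long (_ ∷ _) _       _ _ = s≤s (s≤s (s≤s z≤n))

    -- Common first vertices are stripped until the paths diverge, where `fork` applies. If only one
    -- of them is a single edge they diverge at once, since `b` is not an internal vertex of the
    -- other.
    path-unique : ∀ {a b} p q → Path a p b → Path a q b →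
      2 + (length p + length q) < g → p ≡ q
    path-unique [] [] _ _ _ = refl
    path-unique [] (y ∷ q) P Q short = ⊥-elim (fork [] (y ∷ q) P Q
      (λ { (inj₁ (_ , refl)) (inj₂ (_ , refl)) → proj₁ (proj₂ (path-interior Q)) (here refl) }) short)
    path-unique (x ∷ p) [] P Q short = ⊥-elim (fork (x ∷ p) [] P Q
      (λ { (inj₂ (_ , refl)) (inj₁ (_ , refl)) → proj₁ (proj₂ (path-interior P)) (here refl) }) short)
    path-unique (x ∷ p) (y ∷ q) P Q short with x ≟ y
    ... | yes refl = cong (x ∷_) (path-unique p q (proj₂ (path-split [] P)) (proj₂ (path-split [] Q))
            (ℕ.≤-trans (s≤s (s≤s (s≤s (ℕ.+-mono-≤ (ℕ.n≤1+n _) (ℕ.n≤1+n _))))) short))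
    ... | no x≢y = ⊥-elim (fork (x ∷ p) (y ∷ q) P Q
            (λ { (inj₂ (_ , refl)) (inj₂ (_ , refl)) → x≢y refl }) short)

    -- A common internal vertex cuts both paths into strictly shorter pieces. This gains the strict
    -- inequality that `path-unique` demands and that the whole paths need not satisfy.
    theta : ∀ {a b v} p q → Path a p b → Path a q b → length p ≡ length q →
      2 + (length p + length q) ≤ g → v ∈ p → v ∈ q → p ≡ q
    theta {v = v} p q P Q same short v∈p v∈q with ∈-∃++ v∈p | ∈-∃++ v∈q
    ... | p₁ , p₂ , refl | q₁ , q₂ , refl =
      cong₂ (λ s t → s ++ v ∷ t)
        (path-unique p₁ q₁ (proj₁ (path-split p₁ P)) (proj₁ (path-split q₁ Q))
          (ℕ.<-≤-trans (s≤s (s≤s (ℕ.+-mono-<-≤ (left p₁) (ℕ.<⇒≤ (left q₁))))) short))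
        (path-unique p₂ q₂ (proj₂ (path-split p₁ P)) (proj₂ (path-split q₁ Q))
          (ℕ.<-≤-trans (s≤s (s≤s (ℕ.+-mono-<-≤ (right p₁) (ℕ.<⇒≤ (right q₁))))) short))
      where
      left : ∀ p₁ {p₂} → length p₁ < length (p₁ ++ v ∷ p₂)
      left p₁ {p₂} = ℕ.≤-trans (s≤s (ℕ.m≤m+n _ _)) (ℕ.≤-reflexive (sym (trans (List.length-++ p₁) (ℕ.+-suc _ (length p₂)))))
      right : ∀ p₁ {p₂} → length p₂ < length (p₁ ++ v ∷ p₂)
      right p₁ {p₂} = ℕ.≤-trans (ℕ.m≤n+m _ _) (ℕ.≤-reflexive (sym (List.length-++ p₁)))

-- Paths of length l into a vertex

+-suc-suc : ∀ m n → m + suc (suc n) ≡ suc (suc (m + n))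
+-suc-suc m n = trans (ℕ.+-suc m (suc n)) (cong suc (ℕ.+-suc m n))

-- With h = suc h′ = l ∸ 1 and e = k ∸ l, the two lengths are 2 * l and 2 * k.
module NoLongCycle {V : Set} (_≟_ : B.DecidableEquality V) {_~_ : V → V → Set}
  (~-sym : ∀ {a b} → a ~ b → b ~ a) (h′ e : ℕ)
  (girth : Walks.GirthAtLeast _≟_ {_~_} ~-sym (2 + (suc h′ + suc h′)))
  (no-2k : Walks.NoCycleOfLength _≟_ {_~_} ~-sym (2 + (suc h′ + (suc h′ + e * 2))))
  where

  open Walks _≟_ {_~_} ~-sym
  open Girth girth

  -- A path with `c` internal vertices closes a disjoint one with `h` internal vertices to a cycle
  -- of length 2k. The same `c` is the threshold for rich labels, because the sets to be avoided
  -- never exceed it.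
  h c : ℕ
  h = suc h′
  c = h + e * 2

  no-long-bypass : ∀ {a b} p q → Path a p b → length p ≡ h →
    Path a q b → length q ≡ c → Disjoint q p → ⊥
  no-long-bypass {a} {b} p q P |p| Q |q| dis = no-2k (a ∷ p ++ b ∷ reverse q)
    (paths⇒cycle p q P Q λ (x , y) → dis (y , x))
    (trans (length-paths⇒cycle a b p q) (cong₂ (λ i j → 2 + (i + j)) |p| |q|))

  theta-h : ∀ {a b v} p q → Path a p b → Path a q b → length p ≡ h → length q ≡ h →
    v ∈ p → v ∈ q → p ≡ q
  theta-h p q P Q |p| |q| = theta p q P Q (trans |p| (sym |q|))
    (ℕ.≤-reflexive (cong₂ (λ i j → 2 + (i + j)) |p| |q|))

  module PathsInto (vs : List V) (all-vs : ∀ v → v ∈ vs) (a : V) where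

    -- (w , x , p) stands for the path w , x , p , a.
    Item : Set
    Item = V × V × List V

    Label : Set
    Label = V ⊎ V

    Good : Item → Set
    Good (w , x , p) = Path w (x ∷ p) a × length (x ∷ p) ≡ h

    HasLabel : Item → Label → Set
    HasLabel (w , x , p) (inj₁ v) = w ≡ v
    HasLabel (w , x , p) (inj₂ v) = x ≡ v

    hasLabel? : ∀ i k → Dec (HasLabel i k)
    hasLabel? (w , x , p) (inj₁ v) = w ≟ v
    hasLabel? (w , x , p) (inj₂ v) = x ≟ v

    labels : List Label
    labels = map inj₁ vs ++ map inj₂ vs

    all-labels : ∀ k → k ∈ labels
    all-labels (inj₁ v) = ∈-++⁺ˡ (∈-map⁺ inj₁ (all-vs v))
    all-labels (inj₂ v) = ∈-++⁺ʳ (map inj₁ vs) (∈-map⁺ inj₂ (all-vs v))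

    module Rich (S : List Item) (uS : Unique S) (good : ∀ {i} → i ∈ S → Good i)
      (rich : ∀ {i k} → i ∈ S → HasLabel i k → c < length (filter (λ i → hasLabel? i k) S))
      where

      -- The label `inj₁ w` fixes both ends, so by `theta-h` its more than `c` bearers have pairwise
      -- disjoint interiors, and each vertex of `F` spoils at most one of them.
      freshInterior : ∀ {w x p} → (w , x , p) ∈ S → ∀ F → length F ≤ c →
        ∃₂ λ x′ p′ → (w , x′ , p′) ∈ S × Disjoint (x′ ∷ p′) F
      freshInterior {w} {x} {p} i∈ F |F|
        with ∃-avoiding {Hit = λ (_ , x , p) f → f ∈ (x ∷ p)} (λ (_ , x , p) f → f ∈? (x ∷ p)) F
               (filter (λ i → hasLabel? i (inj₁ w)) S) (Unique.filter⁺ _ uS)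
               once (ℕ.≤-<-trans |F| (rich {k = inj₁ w} i∈ refl))
        where
        once : ∀ {i j f} → i ∈ filter (λ i → hasLabel? i (inj₁ w)) S →
          j ∈ filter (λ i → hasLabel? i (inj₁ w)) S → f ∈ (proj₁ (proj₂ i) ∷ proj₂ (proj₂ i)) →
          f ∈ (proj₁ (proj₂ j) ∷ proj₂ (proj₂ j)) → i ≡ j
        once i∈ j∈ f∈i f∈j with ∈-filter⁻ (λ i → hasLabel? i (inj₁ w)) {xs = S} i∈
                              | ∈-filter⁻ (λ i → hasLabel? i (inj₁ w)) {xs = S} j∈
        ... | i∈S , refl | j∈S , refl with good i∈S | good j∈S
        ... | P , |p| | Q , |q| with refl ← theta-h _ _ P Q |p| |q| f∈i f∈j = refl
      ... | (w′ , x′ , p′) , i′∈ , avoids with ∈-filter⁻ (λ i → hasLabel? i (inj₁ w)) {xs = S} i′∈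
      ...   | i′∈S , refl = x′ , p′ , i′∈S , λ (v∈p , v∈F) → avoids v∈F v∈p

      -- Once `x` is fixed, the start determines the path, because the part from `x` to `a` is short
      -- enough for `path-unique`. So the more than `c` bearers of the label `inj₂ x` have distinct
      -- starts.
      freshStart : ∀ {w x p} → (w , x , p) ∈ S → ∀ F → length F ≤ c →
        ∃₂ λ w′ p′ → (w′ , x , p′) ∈ S × w′ ∉ F
      freshStart {w} {x} {p} i∈ F |F|
        with ∃-avoiding {Hit = λ i f → proj₁ i ≡ f} (λ i f → proj₁ i ≟ f) F
               (filter (λ i → hasLabel? i (inj₂ x)) S) (Unique.filter⁺ _ uS)
               once (ℕ.≤-<-trans |F| (rich {k = inj₂ x} i∈ refl))
        where
        once : ∀ {i j f} → i ∈ filter (λ i → hasLabel? i (inj₂ x)) S →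
          j ∈ filter (λ i → hasLabel? i (inj₂ x)) S → proj₁ i ≡ f → proj₁ j ≡ f → i ≡ j
        once i∈ j∈ refl refl with ∈-filter⁻ (λ i → hasLabel? i (inj₂ x)) {xs = S} i∈
                              | ∈-filter⁻ (λ i → hasLabel? i (inj₂ x)) {xs = S} j∈
        ... | i∈S , refl | j∈S , refl with good i∈S | good j∈S
        ... | P , |p| | Q , |q| with refl ← path-unique _ _ (proj₂ (path-split [] P)) (proj₂ (path-split [] Q))
              (ℕ.<-≤-trans (s≤s (s≤s (ℕ.+-mono-<-≤ (ℕ.≤-reflexive |p|) (ℕ.≤-trans (ℕ.n≤1+n _) (ℕ.≤-reflexive |q|))))) ℕ.≤-refl) = refl
      ... | (w′ , x′ , p′) , i′∈ , avoids with ∈-filter⁻ (λ i → hasLabel? i (inj₂ x)) {xs = S} i′∈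
      ...   | i′∈S , refl = w′ , p′ , i′∈S , λ w′∈F → avoids w′∈F refl

      -- Moving along w, x, w′, where w′ starts another path with second vertex x, adds two edges.
      longPath : ∀ j F {w x p} → (w , x , p) ∈ S → w ∉ F → a ∉ F → length F + j * 2 ≤ c →
        ∃ λ q → Path w q a × length q ≡ h + j * 2 × Disjoint q F
      longPath zero F i∈ w∉F a∉F bound
        with freshInterior i∈ F (ℕ.≤-trans (ℕ.m≤m+n _ _) bound)
      ... | x , p , i′∈ , dis with good i′∈
      ... | P , |p| = x ∷ p , P , trans |p| (sym (ℕ.+-identityʳ h)) , dis
      longPath (suc j) F {w} i∈ w∉F a∉F bound
        with freshInterior i∈ F (ℕ.≤-trans (ℕ.m≤m+n _ _) bound)
      ... | x , p , i′∈ , dis with good i′∈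
      ... | P@((w~x , _) , _) , _ with path-interior {p = x ∷ p} P
            | freshStart i′∈ (w ∷ F) (ℕ.≤-trans (ℕ.≤-trans (s≤s (ℕ.m≤m+n (length F) (j * 2)))
                (ℕ.n≤1+n _)) (ℕ.≤-trans (ℕ.≤-reflexive (sym (+-suc-suc (length F) (j * 2)))) bound))
      ... | w∉ , a∉ , w≢a , _ | w′ , p′ , i″∈ , w′∉ with good i″∈
      ... | P′@((w′~x , _) , _) , _ with path-interior {p = x ∷ p′} P′
      ... | w′∉p , _ , w′≢a , _
        -- `F` gains the two vertices just used while `j * 2` drops by two, so the bound by `c` is
        -- preserved.
        with longPath j (w ∷ x ∷ F) i″∈
               (λ { (here refl) → w′∉ (here refl) ; (there (here refl)) → w′∉p (here refl)
                  ; (there (there w′∈F)) → w′∉ (there w′∈F) })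
               (λ { (here refl) → w≢a refl ; (there (here refl)) → a∉ (here refl)
                  ; (there (there a∈F)) → a∉F a∈F })
               (ℕ.≤-trans (ℕ.≤-reflexive (sym (+-suc-suc (length F) (j * 2)))) bound)
      ... | q , Q@(wq , _) , |q| , disq with path-interior Q
      ... | w′∉q , a∉q , _ , uq = x ∷ w′ ∷ q ,
        mkPath (w~x , ~-sym w′~x , wq) w≢a
          (λ { (here refl) → w∉ (here refl) ; (there (here refl)) → w′∉ (here refl)
             ; (there (there w∈q)) → disq (w∈q , here refl) })
          (λ { (here refl) → a∉ (here refl) ; (there (here refl)) → w′≢a refl
             ; (there (there a∈q)) → a∉q a∈q })
          (Unique-∷⁺ (λ { (here refl) → w′∉p (here refl) ; (there x∈q) → disq (x∈q , there (here refl)) })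
            (Unique-∷⁺ w′∉q uq)) ,
        trans (cong (2 +_) |q|) (sym (+-suc-suc h (j * 2))) ,
        λ { (here refl , v∈F) → dis (here refl , v∈F)
          ; (there (here refl) , v∈F) → w′∉ (there v∈F)
          ; (there (there v∈q) , v∈F) → disq (v∈q , there (there v∈F)) }

    -- In a rich subfamily, `e` zigzags that avoid the interior of one member give a path with `c`
    -- internal vertices, which `no-long-bypass` forbids. Only the counting alternative of `peel`
    -- remains.
    pathsInto-bound : (X : List Item) → Unique X → (∀ {i} → i ∈ X → Good i) →
      length X ≤ (length vs + length vs) * c
    pathsInto-bound X uX good with peel hasLabel? c labels X uX
    ... | inj₁ le = subst (λ s → length X ≤ s * c)
      (trans (List.length-++ (map inj₁ vs)) (cong₂ _+_ (List.length-map inj₁ vs) (List.length-map inj₂ vs))) le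
    ... | inj₂ (S , S⊆X , uS , ((w , x , p) , i∈) , rich) with good (S⊆X i∈)
    ... | P , |p| with path-interior {p = x ∷ p} P
    ... | w∉ , a∉ , _ , _
      with Rich.longPath S uS (good ∘ S⊆X) (λ i∈ → rich i∈ (all-labels _)) e (x ∷ p) i∈ w∉ a∉
             (ℕ.≤-reflexive (cong (_+ e * 2) |p|))
    ... | q , Q , |q| , dis = ⊥-elim (no-long-bypass (x ∷ p) q P |p| Q |q| dis)

-- Rooted cycles of length ml

take-length-++ : (xs : List A) {ys : List A} → take (length xs) (xs ++ ys) ≡ xs
take-length-++ []       = refl
take-length-++ (x ∷ xs) = cong (x ∷_) (take-length-++ xs)

drop-length-++ : (xs : List A) {ys : List A} → drop (length xs) (xs ++ ys) ≡ ys
drop-length-++ []       = refl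
drop-length-++ (x ∷ xs) = drop-length-++ xs

++-cancel-length : (xs xs′ : List A) {ys ys′ : List A} → length xs ≡ length xs′ →
  xs ++ ys ≡ xs′ ++ ys′ → xs ≡ xs′ × ys ≡ ys′
++-cancel-length []       []        _   eq = refl , eq
++-cancel-length (x ∷ xs) (x′ ∷ xs′) len eq with List.∷-injective eq
... | refl , eq′ with ++-cancel-length xs xs′ (ℕ.suc-injective len) eq′
... | refl , ys≡ = refl , ys≡

-- Levi's lemma for words.
++-≡-++ : (xs zs : List A) {ys ws : List A} → xs ++ ys ≡ zs ++ ws →
  (∃ λ vs → zs ≡ xs ++ vs × ys ≡ vs ++ ws) ⊎ (∃ λ vs → xs ≡ zs ++ vs × ws ≡ vs ++ ys)
++-≡-++ []       zs       eq = inj₁ (zs , refl , eq)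
++-≡-++ (x ∷ xs) []       eq = inj₂ (x ∷ xs , refl , sym eq)
++-≡-++ (x ∷ xs) (z ∷ zs) eq with List.∷-injective eq
... | refl , eq′ with ++-≡-++ xs zs eq′
...   | inj₁ (vs , refl , ys≡) = inj₁ (vs , refl , ys≡)
...   | inj₂ (vs , refl , ws≡) = inj₂ (vs , refl , ws≡)

splitEnd : ∀ n (xs : List A) → suc n ≤ length xs →
  ∃₂ λ ys x → ∃ λ zs → xs ≡ ys ++ x ∷ zs × length zs ≡ n
splitEnd n (x ∷ xs) (s≤s n≤) with suc n ℕ.≤? length xs
... | no ≰ = [] , x , xs , refl , ℕ.≤-antisym (s≤s⁻¹ (ℕ.≰⇒> ≰)) n≤
... | yes n< with splitEnd n xs n<
...   | ys , y , zs , refl , len = x ∷ ys , y , zs , refl , len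

unsnoc : ∀ {n} (xs : List A) → length xs ≡ suc n → ∃₂ λ ys y → xs ≡ ys ++ [ y ] × length ys ≡ n
unsnoc {n = n} xs len with splitEnd 0 xs (ℕ.≤-trans (s≤s z≤n) (ℕ.≤-reflexive (sym len)))
... | ys , y , [] , refl , _ = ys , y , refl ,
  ℕ.suc-injective (trans (sym (trans (List.length-++ ys) (ℕ.+-comm (length ys) 1))) len)

rotate : ℕ → List A → List A
rotate j xs = drop j xs ++ take j xs

rotate-++ : (xs : List A) {ys : List A} → rotate (length xs) (xs ++ ys) ≡ ys ++ xs
rotate-++ xs = cong₂ _++_ (drop-length-++ xs) (take-length-++ xs)

length-rotate : ∀ j (xs : List A) → length (rotate j xs) ≡ length xs
length-rotate j xs = trans (Perm.↭-length (Perm.++-comm (drop j xs) (take j xs)))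
  (cong length (List.take++drop≡id j xs))

rotate-injective : ∀ j (xs ys : List A) → length xs ≡ length ys →
  rotate j xs ≡ rotate j ys → xs ≡ ys
rotate-injective j xs ys len eq
  with ++-cancel-length (drop j xs) (drop j ys) (trans (List.length-drop j xs) (trans (cong (_∸ j) len) (sym (List.length-drop j ys)))) eq
... | d≡ , t≡ = trans (sym (List.take++drop≡id j xs)) (trans (cong₂ _++_ t≡ d≡) (List.take++drop≡id j ys))

-- A cycle is rooted at the head of its list: the root `a`, a segment `s` of `suc h′` vertices, then
-- a complement `t` of `L` vertices. `rests` is any list containing all complements; it enters the
-- bound through its length.
module RootedCycles {V : Set} (_≟_ : B.DecidableEquality V) {_~_ : V → V → Set}
  (~-sym : ∀ {a b} → a ~ b → b ~ a) (h′ e L : ℕ)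
  (girth : Walks.GirthAtLeast _≟_ {_~_} ~-sym (2 + (suc h′ + suc h′)))
  (no-2k : Walks.NoCycleOfLength _≟_ {_~_} ~-sym (2 + (suc h′ + (suc h′ + e * 2))))
  (h<L : suc h′ < L)
  (rests : List (List V))
  (all-rests : ∀ a s t → Walks.IsCycle _≟_ {_~_} ~-sym (a ∷ s ++ t) →
    length s ≡ suc h′ → length t ≡ L → t ++ [ a ] ∈ rests)
  where

  open Walks _≟_ {_~_} ~-sym
  open NoLongCycle _≟_ {_~_} ~-sym h′ e girth no-2k

  N : ℕ
  N = suc h + L

  Item : Set
  Item = List V

  Good : Item → Set
  Good u = IsCycle u × length u ≡ N

  good-rotate : ∀ j u → Good u → Good (rotate j u)
  good-rotate j u (cyc , len) =
    cycle-rotate (take j u) (drop j u) (subst IsCycle (sym (List.take++drop≡id j u)) cyc) ,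
    trans (length-rotate j u) len

  corners : ∀ {z a w b F} s {t} → IsCycle (z ∷ a ∷ s ++ w ∷ b ∷ t) → z ∉ F → w ∉ F →
    z ∉ a ∷ b ∷ F × w ∉ a ∷ b ∷ F
  corners {a = a} s (_ , u@(_ ∷ ua)) z∉F w∉F with Unique-++⁻ (a ∷ s) ua
  ... | _ , uw , dis =
    (λ { (here refl) → ∉-head u (here refl)
       ; (there (here refl)) → ∉-head u (∈-++⁺ʳ (a ∷ s) (there (here refl)))
       ; (there (there z∈F)) → z∉F z∈F }) ,
    (λ { (here refl) → dis (here refl , here refl)
       ; (there (here refl)) → ∉-head uw (here refl)
       ; (there (there w∈F)) → w∉F w∈F })

  -- The two extra edges lie on the cycle, where `z` precedes `a` and `w` precedes `b`. They lead
  -- from `a` back to `z` and from `w` on to `b`, so `q` gains two internal vertices.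
  detour : ∀ {z a w b F} s {t} q → IsCycle (z ∷ a ∷ s ++ w ∷ b ∷ t) →
    Path z q w → Disjoint q (a ∷ b ∷ F) → z ∉ F → w ∉ F →
    Path a (z ∷ q ++ [ w ]) b × Disjoint (z ∷ q ++ [ w ]) F
  detour {z} {a} {w} {b} {F} s q cyc@((z~a , wa) , _ ∷ ua) (wq , uq) dis-q z∉F w∉F
    with walk-split s wa | Unique-++⁻ (a ∷ s) ua | corners {F = []} s cyc (λ ()) (λ ())
  ... | _ , (w~b , _) | _ , _ , dis | z∉ , w∉ =
    mkPath (~-sym z~a , walk-++ q wq w~b) (λ { refl → dis (here refl , there (here refl)) })
      (avoids (here refl)) (avoids (there (here refl))) uq ,
    λ { (here refl , v∈F) → z∉F v∈F
      ; (there v∈ , v∈F) → [ (λ v∈q → dis-q (v∈q , there (there v∈F)))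
                           , (λ { (here refl) → w∉F v∈F }) ]′ (∈-++⁻ q v∈) }
    where
    widen : ∀ {v} → v ∈ a ∷ b ∷ [] → v ∈ a ∷ b ∷ F
    widen (here eq) = here eq
    widen (there (here eq)) = there (here eq)
    avoids : ∀ {v} → v ∈ a ∷ b ∷ [] → v ∉ z ∷ q ++ [ w ]
    avoids v∈ (here refl) = z∉ v∈
    avoids v∈ (there v∈q++) with ∈-++⁻ q v∈q++
    ... | inj₁ v∈q = dis-q (v∈q , widen v∈)
    ... | inj₂ (here refl) = w∉ v∈

  -- The root is appended to the complement so that `rest` records both ends of the segment; cycles
  -- with equal rests can differ only in `seg`.
  rest seg : List V → List V
  rest u = drop (suc h) u ++ take 1 u
  seg  u = take h (drop 1 u)

  length-seg : ∀ u → length u ≡ N → length (seg u) ≡ h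
  length-seg (x ∷ u) len = trans (List.length-take h u)
    (ℕ.m≤n⇒m⊓n≡m (ℕ.≤-trans (ℕ.m≤m+n h L) (ℕ.≤-reflexive (sym (ℕ.suc-injective len)))))

  rest-++ : ∀ a s t → length s ≡ h → rest (a ∷ s ++ t) ≡ t ++ [ a ]
  rest-++ a s t len = cong (_++ [ a ])
    (trans (cong (λ n → drop n (s ++ t)) (sym len)) (drop-length-++ s))

  parse : ∀ a t u → length u ≡ N → rest u ≡ t ++ [ a ] → u ≡ a ∷ seg u ++ t
  parse a t (x ∷ u) len eq with List.∷ʳ-injective (drop h u) t eq
  ... | d≡ , refl = cong (x ∷_) (trans (sym (List.take++drop≡id h u)) (cong (take h u ++_) d≡))

  Label : Set
  Label = ℕ × List V

  HasLabel : Item → Label → Set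
  HasLabel u (j , r) = rest (rotate j u) ≡ r

  hasLabel? : ∀ u k → Dec (HasLabel u k)
  hasLabel? u (j , r) = List.≡-dec _≟_ (rest (rotate j u)) r

  -- The shift will be the length of a prefix, possibly of the whole list, hence the `suc N` values
  -- from 0 to `N`.
  labels : List Label
  labels = cartesianProduct (upTo (suc N)) rests

  module Rich (S : List Item) (uS : Unique S) (good : ∀ {u} → u ∈ S → Good u)
    (rich : ∀ {u k} → u ∈ S → k ∈ labels → HasLabel u k →
      c < length (filter (λ u → hasLabel? u k) S))
    where

    -- `S` need not be closed under rotation. The split keeps track of the shift that carries the
    -- member of `S` to `v`, and this shift is part of the label.
    Alive : List V → Set
    Alive v = ∃₂ λ p q → p ++ q ∈ S × v ≡ q ++ p

    alive-good : ∀ {v} → Alive v → Good v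
    alive-good (p , q , u∈ , refl) with good u∈
    ... | cyc , len = cycle-rotate p q cyc , trans (Perm.↭-length (Perm.++-comm q p)) len

    alive-rotate : ∀ x y → Alive (x ++ y) → Alive (y ++ x)
    alive-rotate x y (p , q , u∈ , eq) with ++-≡-++ x q eq
    ... | inj₁ (v , refl , refl) = p ++ x , v ,
            subst (_∈ S) (sym (List.++-assoc p x v)) u∈ , List.++-assoc v p x
    ... | inj₂ (v , refl , refl) = v , y ++ q ,
            subst (_∈ S) (List.++-assoc v y q) u∈ , sym (List.++-assoc y q v)

    alive-length : ∀ {a} s {t} → Alive (a ∷ s ++ t) → length s ≡ h → length t ≡ L
    alive-length s al len = ℕ.+-cancelˡ-≡ h _ _ (trans (cong (_+ _) (sym len))
      (trans (sym (List.length-++ s)) (ℕ.suc-injective (proj₂ (alive-good al)))))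

    -- The bearers of the label given by the shift and the complement differ only in the segment
    -- from `a` to `b`. By `theta-h` these segments are pairwise disjoint, and there are more than
    -- `c` of them.
    freshen : ∀ {a b} s t → Alive (a ∷ s ++ b ∷ t) → length s ≡ h → ∀ F → length F ≤ c →
      ∃ λ s′ → Alive (a ∷ s′ ++ b ∷ t) × length s′ ≡ h × Disjoint s′ F
    freshen {a} {b} s t al@(p , q , u∈ , eq) |s| F |F|
      with ∃-avoiding {Hit = λ u f → f ∈ seg (rotate j u)} (λ u f → f ∈? seg (rotate j u)) F
             (filter hasLab? S) (Unique.filter⁺ _ uS) once
             (ℕ.≤-<-trans |F| (rich {k = lab} u∈ lab∈ hasLab))
      where
      j = length p
      lab = j , (b ∷ t) ++ [ a ]
      hasLab? : ∀ u → Dec (HasLabel u lab)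
      hasLab? u = hasLabel? u lab
      cyc : IsCycle (a ∷ s ++ b ∷ t)
      cyc = proj₁ (alive-good al)
      hasLab : HasLabel (p ++ q) lab
      hasLab = trans (cong rest (trans (rotate-++ p) (sym eq))) (rest-++ a s (b ∷ t) |s|)
      lab∈ : lab ∈ labels
      lab∈ = ∈-cartesianProduct⁺
        (∈-upTo⁺ (s≤s (ℕ.≤-trans (ℕ.m≤m+n j (length q)) (ℕ.≤-reflexive (trans (sym (List.length-++ p)) (proj₂ (good u∈)))))))
        (all-rests a s (b ∷ t) cyc |s| (alive-length s al |s|))
      once : ∀ {u u′ f} → u ∈ filter hasLab? S → u′ ∈ filter hasLab? S →
        f ∈ seg (rotate j u) → f ∈ seg (rotate j u′) → u ≡ u′
      once {u} {u′} u∈ u′∈ f∈ f∈′ with ∈-filter⁻ hasLab? {xs = S} u∈ | ∈-filter⁻ hasLab? {xs = S} u′∈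
      ... | u∈S , r | u′∈S , r′ with good-rotate j u (good u∈S) | good-rotate j u′ (good u′∈S)
      ... | cyc , len | cyc′ , len′ = rotate-injective j u u′ (trans (proj₂ (good u∈S)) (sym (proj₂ (good u′∈S))))
          (trans v≡ (trans (cong (λ s → a ∷ s ++ b ∷ t) seg≡) (sym v′≡)))
        where
        v≡ = parse a (b ∷ t) (rotate j u) len r
        v′≡ = parse a (b ∷ t) (rotate j u′) len′ r′
        seg≡ : seg (rotate j u) ≡ seg (rotate j u′)
        seg≡ = theta-h _ _ (cycle⇒path _ (subst IsCycle v≡ cyc)) (cycle⇒path _ (subst IsCycle v′≡ cyc′))
          (length-seg (rotate j u) len) (length-seg (rotate j u′) len′) f∈ f∈′
    ... | u , u∈f , avoids with ∈-filter⁻ (λ u → hasLabel? u (length p , (b ∷ t) ++ [ a ])) {xs = S} u∈f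
    ... | u∈S , r = seg (rotate j u) ,
        (take j u , drop j u , subst (_∈ S) (sym (List.take++drop≡id j u)) u∈S ,
          sym (parse a (b ∷ t) (rotate j u) len r)) ,
        length-seg (rotate j u) len , λ (v∈s , v∈F) → avoids v∈F v∈s
      where
      j = length p
      len = proj₂ (good-rotate j u (good u∈S))

    -- The segment from z to w is the segment from a to b turned back by one step.
    TurnedBack : V → V → List V → Set
    TurnedBack a b F = ∃₂ λ z s → ∃₂ λ w t →
      Alive (z ∷ (a ∷ s) ++ w ∷ b ∷ t) × length (a ∷ s) ≡ h × z ∉ F × w ∉ F

    turnBack : ∀ {a b x F} s r r₀ y t → Alive (x ∷ r ++ a ∷ (s ++ y)) →
      b ∷ t ≡ y ++ x ∷ r₀ → length s ≡ h → length r ≡ h → Disjoint s F → Disjoint r F →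
      TurnedBack a b F
    turnBack {a} {b} {x} s r r₀ y t al bt≡ |s| |r| dis-s dis-r with unsnoc s |s| | unsnoc r |r|
    ... | s′ , w , refl , |s′| | r′ , z , refl , _ =
      z , s′ , w , proj₁ (startsWith-b y bt≡) ,
      subst Alive
        (cong (λ r → z ∷ a ∷ r) (trans (List.++-assoc (s′ ++ [ w ]) y (x ∷ r′))
          (trans (List.++-assoc s′ [ w ] (y ++ x ∷ r′))
            (cong (λ r → s′ ++ w ∷ r) (proj₂ (startsWith-b y bt≡))))))
        (alive-rotate (x ∷ r′) (z ∷ a ∷ (s′ ++ [ w ]) ++ y)
          (subst Alive (cong (x ∷_) (List.++-assoc r′ [ z ] _)) al)) ,
      cong suc |s′| ,
      (λ z∈F → dis-r (∈-++⁺ʳ r′ (here refl) , z∈F)) ,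
      (λ w∈F → dis-s (∈-++⁺ʳ s′ (here refl) , w∈F))
      where
      -- For empty `y` the vertices `b` and `x` coincide; in both cases exchanging `r₀` for `r′`
      -- keeps `b` in place.
      startsWith-b : ∀ y → b ∷ t ≡ y ++ x ∷ r₀ → ∃ λ t′ → y ++ x ∷ r′ ≡ b ∷ t′
      startsWith-b []      refl = r′ , refl
      startsWith-b (_ ∷ y) refl = y ++ x ∷ r′ , refl

    -- Two exchanges: a fresh segment from `a` to `b` has its last vertex `w` outside `F`, and a
    -- fresh segment ending just before `a` has its last vertex `z` outside `F`. The second exchange
    -- leaves the first segment as it is.
    turnBackFresh : ∀ {a b F} s t → Alive (a ∷ s ++ b ∷ t) → length s ≡ h → length F ≤ c →
      TurnedBack a b F
    turnBackFresh {a} {b} {F} s t al |s| |F| =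
      let s′ , al′ , |s′| , dis-s = freshen s t al |s| F |F|
          -- By `h<L` the last `h` vertices of the complement do not reach back to `b`, so the
          -- second exchange does not move `b`.
          y , x , r , bt≡ , |r| = splitEnd h (b ∷ t) (subst (suc h ≤_) (sym (alive-length s al |s|)) h<L)
          r′ , al″ , |r′| , dis-r = freshen r (s′ ++ y)
            (alive-rotate (a ∷ s′ ++ y) (x ∷ r) (subst Alive
              (cong (a ∷_) (trans (cong (s′ ++_) bt≡) (sym (List.++-assoc s′ y (x ∷ r))))) al′))
            |r| F |F|
      in turnBack s′ r′ r y t al″ bt≡ |s′| |r′| dis-s dis-r

    -- Turning the segment back by one step and bypassing the turned segment adds two edges.
    bypass : ∀ j F {a b} s t → Alive (a ∷ s ++ b ∷ t) → length s ≡ h → a ∉ F → b ∉ F →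
      length F + j * 2 ≤ c → ∃ λ q → Path a q b × length q ≡ h + j * 2 × Disjoint q F
    bypass zero F s t al |s| a∉F b∉F bound =
      let s′ , al′ , |s′| , dis = freshen s t al |s| F (ℕ.≤-trans (ℕ.m≤m+n _ _) bound)
      in s′ , cycle⇒path s′ (proj₁ (alive-good al′)) , trans |s′| (sym (ℕ.+-identityʳ h)) , dis
    bypass (suc j) F {a} {b} s t al |s| a∉F b∉F bound =
      let z , s₃ , w , t₃ , al₃ , |as₃| , z∉F , w∉F =
            turnBackFresh s t al |s| (ℕ.≤-trans (ℕ.m≤m+n _ _) bound)
          cyc = proj₁ (alive-good al₃)
          z∉ , w∉ = corners s₃ cyc z∉F w∉F
          -- Avoiding `a` and `b` costs two places in the set, paid for by the decrease of `j`.
          q , Q , |q| , dis-q = bypass j (a ∷ b ∷ F) (a ∷ s₃) (b ∷ t₃) al₃ |as₃| z∉ w∉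
            (ℕ.≤-trans (ℕ.≤-reflexive (sym (+-suc-suc (length F) (j * 2)))) bound)
          P , dis = detour s₃ q cyc Q dis-q z∉F w∉F
      in z ∷ q ++ [ w ] , P ,
         trans (cong suc (trans (List.length-++ q) (ℕ.+-comm (length q) 1)))
           (trans (cong (2 +_) |q|) (sym (+-suc-suc h (j * 2)))) ,
         dis

  initialSegment : ∀ u → length u ≡ N →
    ∃₂ λ a s → ∃₂ λ b t → u ≡ a ∷ s ++ b ∷ t × length s ≡ h
  initialSegment u@(a ∷ v) len with drop h v | List.length-drop h v | List.take++drop≡id h v
  ... | [] | 0≡ | _ = contradiction
    (trans 0≡ (trans (cong (_∸ h) (ℕ.suc-injective len)) (ℕ.m+n∸m≡n h L)))
    (ℕ.<⇒≢ (ℕ.≤-trans (s≤s z≤n) h<L))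
  ... | b ∷ t | _ | eq = a , take h v , b , t , cong (a ∷_) (sym eq) , length-seg u len

  -- In a rich subfamily, `bypass` with the segment `s` itself as the set to avoid gives a path that
  -- closes `s` to a cycle of length 2k.
  rooted-bound : (X : List Item) → Unique X → (∀ {u} → u ∈ X → Good u) →
    length X ≤ length labels * c
  rooted-bound X uX good with peel hasLabel? c labels X uX
  ... | inj₁ le = le
  ... | inj₂ (S , S⊆X , uS , (u , u∈) , rich) with initialSegment u (proj₂ (good (S⊆X u∈)))
  ... | a , s , b , t , refl , |s| with cycle⇒path s (proj₁ (good (S⊆X u∈)))
  ... | P with path-interior {p = s} P
  ... | a∉ , b∉ , _ =
    let q , Q , |q| , dis = Rich.bypass S uS (good ∘ S⊆X) rich e s s t
          ([] , u , u∈ , sym (List.++-identityʳ u)) |s| a∉ b∉ (ℕ.≤-reflexive (cong (_+ e * 2) |s|))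
    in ⊥-elim (no-long-bypass s q P |s| Q |q| dis)

-- Graphs and subgraphs

adj-irrefl : (G : Graph n) → ∀ i → ¬ Adj G i i
adj-irrefl (mkGraph N s) = proj₁ (recompute (simple? N) s)

adj-sym : (G : Graph n) → ∀ {i j} → Adj G i j → Adj G j i
adj-sym (mkGraph N s) = proj₂ (recompute (simple? N) s) _ _

module _ {R : Rel (Fin n) 0ℓ} (R? : B.Decidable R) where

  -- By definition these are the neighbourhoods of `fromRel R?`, so the two membership lemmas below
  -- translate the edges of every graph built with `fromRel`, in particular of `C k`.
  matrix : Neighbourhoods n
  matrix = Vec.tabulate λ i → Vec.tabulate λ j → does (R? i j)

  lookup-matrix : ∀ i j → Vec.lookup (Vec.lookup matrix i) j ≡ does (R? i j)
  lookup-matrix i j = trans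
    (cong (λ v → Vec.lookup v j) (Vec.lookup∘tabulate (λ i → Vec.tabulate λ j → does (R? i j)) i))
    (Vec.lookup∘tabulate (λ j → does (R? i j)) j)

  ∈-matrix⁺ : ∀ {i j} → R i j → j Subset.∈ Vec.lookup matrix i
  ∈-matrix⁺ {i} {j} r with R? i j | lookup-matrix i j
  ... | yes _ | eq = Vec.lookup⇒[]= j _ eq
  ... | no ¬r | _  = contradiction r ¬r

  ∈-matrix⁻ : ∀ {i j} → j Subset.∈ Vec.lookup matrix i → R i j
  ∈-matrix⁻ {i} {j} j∈ with R? i j | trans (sym (lookup-matrix i j)) (Vec.[]=⇒lookup j∈)
  ... | yes r | _ = r

CycleAdj : ∀ k → Rel (Fin k) 0ℓ
CycleAdj k i j = i ≢ j × (Next i j ⊎ Next j i)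

cycleAdj? : ∀ k → B.Decidable (CycleAdj k)
cycleAdj? k i j = ¬? (i Fin.≟ j) ×-dec (next? i j ⊎-dec next? j i)

C-adj⁺ : ∀ {i j} → CycleAdj k i j → Adj (C k) i j
C-adj⁺ {k} = ∈-matrix⁺ (cycleAdj? k)

C-adj⁻ : ∀ {i j} → Adj (C k) i j → CycleAdj k i j
C-adj⁻ {k} = ∈-matrix⁻ (cycleAdj? k)

-- Extensionality and enumeration of graphs and subgraphs

vec-ext : {xs ys : Vec A n} → (∀ i → Vec.lookup xs i ≡ Vec.lookup ys i) → xs ≡ ys
vec-ext {xs = xs} {ys} eq =
  trans (sym (Vec.tabulate∘lookup xs)) (trans (Vec.tabulate-cong eq) (Vec.tabulate∘lookup ys))

graph-ext : {G H : Graph n} → (∀ i j → Adj G i j → Adj H i j) → (∀ i j → Adj H i j → Adj G i j) → G ≡ H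
graph-ext {G = mkGraph N _} {mkGraph N′ _} G⊆H H⊆G
  with vec-ext {xs = N} {N′} (λ i → Subset.⊆-antisym (λ {j} → G⊆H i j) (λ {j} → H⊆G i j))
... | refl = refl

vectors-unique : {xs : List A} → Unique xs → ∀ k → Unique (vectors xs k)
vectors-unique u zero    = [] ∷ []
vectors-unique u (suc k) = Unique.cartesianProductWith⁺ _∷_ Vec.∷-injective u (vectors-unique u k)

∈-vectors : {xs : List A} (v : Vec A k) → (∀ i → Vec.lookup v i ∈ xs) → v ∈ vectors xs k
∈-vectors []      _  = here refl
∈-vectors (x ∷ v) x∈ = ∈-cartesianProductWith⁺ _∷_ (x∈ zero) (∈-vectors v (x∈ ∘ suc))

bools-unique : Unique (true ∷ false ∷ [])
bools-unique = ((λ ()) ∷ []) ∷ [] ∷ []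

∈-subsets : (V : Subset n) → V ∈ vectors (true ∷ false ∷ []) n
∈-subsets V = ∈-vectors V λ i → bool (Vec.lookup V i)
  where
  bool : ∀ b → b ∈ true ∷ false ∷ []
  bool true  = here refl
  bool false = there (here refl)

toGraph : Neighbourhoods n → Maybe (Graph n)
toGraph N = Maybe.map (λ s → mkGraph N s) (dec⇒maybe (simple? N))

toGraph-just : ∀ (N : Neighbourhoods n) {G} → toGraph N ≡ just G → N ≡ neighbours G
toGraph-just N eq with dec⇒maybe (simple? N)
toGraph-just N refl | just _ = refl

∈-mapMaybe-toGraph⁻ : ∀ (Ns : List (Neighbourhoods n)) {G} → G ∈ List.mapMaybe toGraph Ns → neighbours G ∈ Ns
∈-mapMaybe-toGraph⁻ (N ∷ Ns) G∈ with toGraph N in eq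
... | nothing = there (∈-mapMaybe-toGraph⁻ Ns G∈)
... | just _ with G∈
...   | here refl = here (sym (toGraph-just N eq))
...   | there G∈′ = there (∈-mapMaybe-toGraph⁻ Ns G∈′)

∈-mapMaybe-toGraph⁺ : ∀ (Ns : List (Neighbourhoods n)) (G : Graph n) → neighbours G ∈ Ns → G ∈ List.mapMaybe toGraph Ns
∈-mapMaybe-toGraph⁺ (.N ∷ Ns) (mkGraph N s) (here refl) with simple? N
... | yes _ = here refl
... | no ¬s = ⊥-elim (¬s (recompute (simple? N) s))
∈-mapMaybe-toGraph⁺ (N ∷ Ns) G (there N∈) with toGraph N
... | nothing = ∈-mapMaybe-toGraph⁺ Ns G N∈
... | just _  = there (∈-mapMaybe-toGraph⁺ Ns G N∈)

mapMaybe-toGraph-unique : {Ns : List (Neighbourhoods n)} → Unique Ns → Unique (List.mapMaybe toGraph Ns)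
mapMaybe-toGraph-unique [] = []
mapMaybe-toGraph-unique {Ns = N ∷ Ns} (N∉ ∷ u) with toGraph N in eq
... | nothing = mapMaybe-toGraph-unique u
... | just G  = Unique-∷⁺ (λ G∈ → All.lookup N∉ (∈-mapMaybe-toGraph⁻ Ns G∈) (toGraph-just N eq))
  (mapMaybe-toGraph-unique u)

graphs-unique : ∀ n → Unique (graphs n)
graphs-unique n = mapMaybe-toGraph-unique (vectors-unique (vectors-unique bools-unique n) n)

∈-graphs : (G : Graph n) → G ∈ graphs n
∈-graphs G = ∈-mapMaybe-toGraph⁺ _ G (∈-vectors (neighbours G) (λ i → ∈-subsets (Vec.lookup (neighbours G) i)))

subs-unique : ∀ n → Unique (subs n)
subs-unique n = Unique.cartesianProduct⁺ (vectors-unique bools-unique n) (graphs-unique n)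

∈-subs : (S : Sub n) → S ∈ subs n
∈-subs (V , E) = ∈-cartesianProduct⁺ (∈-subsets V) (∈-graphs E)

-- The vertex set is the image of `φ`. The ends of an edge lie in the vertex set, hence in that
-- image, so the edge pulls back to `H` and can be pushed into the other subgraph.
copy-determined : ∀ {h} {H : Graph h} {G : Graph n} {S S′ : Sub n} {φ} →
  IsSubgraphOf G S → IsSubgraphOf G S′ → IsIso H S φ → IsIso H S′ φ → S ≡ S′
copy-determined {H = H} {G} {S} {S′} {φ} sub sub′ iso iso′ = cong₂ _,_
  (Subset.⊆-antisym (V⊆ {S} {S′} iso iso′) (V⊆ {S′} {S} iso′ iso))
  (graph-ext (E⊆ {S} {S′} sub iso iso′) (E⊆ {S′} {S} sub′ iso′ iso))
  where
  V⊆ : ∀ {S S′ : Sub _} → IsIso H S φ → IsIso H S′ φ → ∀ {v} → v Subset.∈ proj₁ S → v Subset.∈ proj₁ S′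
  V⊆ (_ , _ , onto , _) (_ , into , _) v∈ with onto _ v∈
  ... | i , refl = into i
  E⊆ : ∀ {S S′ : Sub _} → IsSubgraphOf G S → IsIso H S φ → IsIso H S′ φ →
    ∀ u v → Adj (proj₂ S) u v → Adj (proj₂ S′) u v
  E⊆ sub (_ , _ , onto , _ , reflects) (_ , _ , _ , preserves , _) u v uv with sub u v uv
  ... | _ , u∈ , v∈ with onto u u∈ | onto v v∈
  ... | i , refl | j , refl = preserves i j (reflects i j uv)

-- Counting the complements of segments

length-concatMap-≤ : (f : X → List Y) (b : ℕ) (xs : List X) → (∀ {x} → x ∈ xs → length (f x) ≤ b) →
  length (concatMap f xs) ≤ length xs * b
length-concatMap-≤ f b [] _ = z≤n
length-concatMap-≤ f b (x ∷ xs) le = ℕ.≤-trans (ℕ.≤-reflexive (List.length-++ (f x)))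
  (ℕ.+-mono-≤ (le (here refl)) (length-concatMap-≤ f b xs (le ∘ there)))

length-cartesianProductWith : (f : X → Y → K) (xs : List X) (ys : List Y) →
  length (cartesianProductWith f xs ys) ≡ length xs * length ys
length-cartesianProductWith f []       ys = refl
length-cartesianProductWith f (x ∷ xs) ys = trans (List.length-++ (map (f x) ys))
  (cong₂ _+_ (List.length-map (f x) ys) (length-cartesianProductWith f xs ys))

toList-injective : {u v : Vec A k} → Vec.toList u ≡ Vec.toList v → u ≡ v
toList-injective {u = u} {v} eq =
  trans (sym (Vec.cast-is-id refl u)) (Vec.toList-injective refl u v eq)

lists : List A → ℕ → List (List A)
lists xs k = map Vec.toList (vectors xs k)

lists-unique : {xs : List A} → Unique xs → ∀ k → Unique (lists xs k)
lists-unique u k = Unique.map⁺ toList-injective (vectors-unique u k)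

∈-lists : {vs : List A} → (∀ v → v ∈ vs) → (xs : List A) → xs ∈ lists vs (length xs)
∈-lists all xs = subst (_∈ lists _ (length xs)) (Vec.toList∘fromList xs)
  (∈-map⁺ Vec.toList (∈-vectors (Vec.fromList xs) (λ i → all _)))

module Blocks {V : Set} (_≟_ : B.DecidableEquality V) {_~_ : V → V → Set}
  (_~?_ : B.Decidable _~_) (~-sym : ∀ {a b} → a ~ b → b ~ a) (h′ e : ℕ)
  (girth : Walks.GirthAtLeast _≟_ {_~_} ~-sym (2 + (suc h′ + suc h′)))
  (no-2k : Walks.NoCycleOfLength _≟_ {_~_} ~-sym (2 + (suc h′ + (suc h′ + e * 2))))
  (vs : List V) (vs-unique : Unique vs) (all-vs : ∀ v → v ∈ vs)
  where

  open Walks _≟_ {_~_} ~-sym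
  open NoLongCycle _≟_ {_~_} ~-sym h′ e girth no-2k

  walk? : ∀ a p b → Dec (Walk a p b)
  walk? a []      b = a ~? b
  walk? a (x ∷ p) b = (a ~? x) ×-dec walk? x p b

  path? : ∀ a p b → Dec (Path a p b)
  path? a p b = walk? a p b ×-dec UniqueDec.unique? _≟_ (a ∷ p ++ [ b ])

  D : ℕ
  D = (length vs + length vs) * c

  module _ (a : V) where

    open PathsInto vs all-vs a

    good? : ∀ i → Dec (Good i)
    good? (w , x , p) = path? w (x ∷ p) a ×-dec (length (x ∷ p) ℕ.≟ h)

    candidates blocks : List Item
    candidates = cartesianProduct vs (cartesianProduct vs (lists vs h′))
    blocks = filter good? candidates

    blocks-bound : length blocks ≤ D
    blocks-bound = pathsInto-bound blocks
      (Unique.filter⁺ good? (Unique.cartesianProduct⁺ vs-unique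
        (Unique.cartesianProduct⁺ vs-unique (lists-unique vs-unique h′))))
      (proj₂ ∘ ∈-filter⁻ good? {xs = candidates})

    ∈-blocks : ∀ {w x p} → Path w (x ∷ p) a → length (x ∷ p) ≡ h → (w , x , p) ∈ blocks
    ∈-blocks {w} {x} {p} P |p| = ∈-filter⁺ good?
      (∈-cartesianProduct⁺ (all-vs w) (∈-cartesianProduct⁺ (all-vs x)
        (subst (λ k → p ∈ lists vs k) (ℕ.suc-injective |p|) (∈-lists all-vs p))))
      (P , |p|)

  -- The last block leads to `a` and starts at `w`, where the shorter chain has to end. Blocks are
  -- joined without asking for disjointness; extra lists do no harm in an upper bound.
  chains : ℕ → V → List (List V)
  chains zero    a = [ [] ]
  chains (suc j) a = concatMap (λ (w , x , p) → map (_++ w ∷ x ∷ p) (chains j w)) (blocks a)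

  chains-bound : ∀ j a → length (chains j a) ≤ D ^ j
  chains-bound zero    a = s≤s z≤n
  chains-bound (suc j) a = ℕ.≤-trans
    (length-concatMap-≤ _ (D ^ j) (blocks a) λ {(w , x , p)} _ →
      ℕ.≤-trans (ℕ.≤-reflexive (List.length-map _ (chains j w))) (chains-bound j w))
    (ℕ.*-monoˡ-≤ (D ^ j) (blocks-bound a))

  ToPath : List V → V → Set
  ToPath []      a = ⊤
  ToPath (b ∷ r) a = Path b r a

  toPath-split : ∀ t {w p a} → ToPath (t ++ w ∷ p) a → ToPath t w × Path w p a
  toPath-split []      P = tt , P
  toPath-split (b ∷ r) P = path-split r P

  ∈-chains : ∀ j a t → ToPath t a → length t ≡ j * suc h → t ∈ chains j a
  ∈-chains zero    a []  P |t| = here refl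
  ∈-chains (suc j) a t P |t|
    with splitEnd h t (ℕ.≤-trans (ℕ.m≤m+n (suc h) (j * suc h)) (ℕ.≤-reflexive (sym |t|)))
  ... | t′ , w , x ∷ p , refl , |p| with toPath-split t′ P
  ... | P′ , Q = ∈-concatMap⁺ _ (lose (∈-blocks a Q |p|) (∈-map⁺ (_++ w ∷ x ∷ p) (∈-chains j w t′ P′ |t′|)))
    where
    |t′| : length t′ ≡ j * suc h
    |t′| = ℕ.+-cancelʳ-≡ (suc h) _ _ (trans (trans (cong (λ n → length t′ + suc n) (sym |p|))
      (sym (List.length-++ t′))) (trans |t| (ℕ.+-comm (suc h) (j * suc h))))

  module _ (m′ : ℕ) where

    L : ℕ
    L = suc m′ * suc h

    rests : List (List V)
    rests = concatMap (λ a → map (_++ [ a ]) (chains (suc m′) a)) vs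

    rests-bound : length rests ≤ length vs * D ^ suc m′
    rests-bound = length-concatMap-≤ _ (D ^ suc m′) vs λ {a} _ →
      ℕ.≤-trans (ℕ.≤-reflexive (List.length-map _ (chains (suc m′) a))) (chains-bound (suc m′) a)

    -- Rotated so that `t` comes first, the cycle runs through `t` into `a`; hence `t` is a chain of
    -- `suc m′` blocks ending at `a`.
    all-rests : ∀ a s t → IsCycle (a ∷ s ++ t) → length s ≡ h → length t ≡ L → t ++ [ a ] ∈ rests
    all-rests a s t@(b ∷ r) cyc |s| |t| = ∈-concatMap⁺ _ (lose (all-vs a)
      (∈-map⁺ (_++ [ a ]) (∈-chains (suc m′) a t (cycle⇒path r (cycle-rotate (a ∷ s) t cyc)) |t|)))

    open RootedCycles _≟_ {_~_} ~-sym h′ e L girth no-2k (ℕ.m≤m+n (suc h) (m′ * suc h)) rests all-rests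
      using (rooted-bound)

    cycles-bound : (X : List (List V)) → Unique X →
      (∀ {u} → u ∈ X → IsCycle u × length u ≡ suc h + L) →
      length X ≤ (suc (suc h + L) * (length vs * D ^ suc m′)) * c
    cycles-bound X uX good = ℕ.≤-trans (rooted-bound X uX good)
      (ℕ.*-monoˡ-≤ c (ℕ.≤-trans (ℕ.≤-reflexive (length-cartesianProductWith _,_ (upTo (suc (suc h + L))) rests))
        (ℕ.*-mono-≤ (ℕ.≤-reflexive (List.length-upTo (suc (suc h + L)))) rests-bound)))

-- Cycles as lists, copies as cycles

fromList-injective : {xs : List (Fin n)} → Unique xs → Injective (Vec.fromList xs)
fromList-injective u i j = VecUnique.lookup-injective (fromList-unique u) i j
  where
  fromList-unique : {xs : List A} → Unique xs → VecUnique.Unique (Vec.fromList xs)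
  fromList-unique [] = []
  fromList-unique (x∉ ∷ u) = VecAll.fromList⁺ x∉ ∷ fromList-unique u

module ListCycles (G : Graph n) where

  open Walks Fin._≟_ {Adj G} (adj-sym G) public

  walk-step : ∀ a p {b} → Walk a p b → ∀ i j → suc (toℕ i) ≡ toℕ j →
    Adj G (Vec.lookup (a ∷ Vec.fromList p) i) (Vec.lookup (a ∷ Vec.fromList p) j)
  walk-step a (x ∷ p) (e , w) zero    (suc zero) _  = e
  walk-step a (x ∷ p) (e , w) (suc i) (suc j)    eq = walk-step x p w i j (ℕ.suc-injective eq)

  walk-last : ∀ a p {b} → Walk a p b → ∀ i → toℕ i ≡ length p →
    Adj G (Vec.lookup (a ∷ Vec.fromList p) i) b
  walk-last a []      e       zero    _  = e
  walk-last a (x ∷ p) (_ , w) (suc i) eq = walk-last x p w i (ℕ.suc-injective eq)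

  cycle⇒contains : ∀ xs → IsCycle xs → Contains G (C (length xs))
  cycle⇒contains (a ∷ p) (w , u) = φ , fromList-injective u , λ i j ij → edge i j (C-adj⁻ {i = i} {j} ij)
    where
    φ = Vec.fromList (a ∷ p)
    step : ∀ i j → Next i j → Adj G (Vec.lookup φ i) (Vec.lookup φ j)
    step i j    (inj₁ eq)       = walk-step a p w i j eq
    step i zero (inj₂ (eq , _)) = walk-last a p w i (ℕ.suc-injective eq)
    edge : ∀ i j → CycleAdj (length (a ∷ p)) i j → Adj G (Vec.lookup φ i) (Vec.lookup φ j)
    edge i j (_ , inj₁ ij) = step i j ij
    edge i j (_ , inj₂ ji) = adj-sym G (step j i ji)

  steps⇒walk : ∀ a (v : Vec (Fin n) k) {b} →
    (∀ i j → suc (toℕ i) ≡ toℕ j → Adj G (Vec.lookup (a ∷ v) i) (Vec.lookup (a ∷ v) j)) →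
    (∀ i → toℕ i ≡ k → Adj G (Vec.lookup (a ∷ v) i) b) → Walk a (Vec.toList v) b
  steps⇒walk a []      step last = last zero refl
  steps⇒walk a (x ∷ v) step last = step zero (suc zero) refl ,
    steps⇒walk x v (λ i j eq → step (suc i) (suc j) (cong suc eq)) (λ i eq → last (suc i) (cong suc eq))

  toList-unique : (φ : Vec (Fin n) k) → Injective φ → Unique (Vec.toList φ)
  toList-unique []      inj = []
  toList-unique (x ∷ v) inj = Unique-∷⁺ (x∉ v (λ i eq → contradiction (inj zero (suc i) eq) λ ()))
      (toList-unique v (λ i j eq → Fin.suc-injective (inj (suc i) (suc j) eq)))
    where
    x∉ : (v : Vec (Fin n) k) → (∀ i → x ≢ Vec.lookup v i) → x ∉ Vec.toList v
    x∉ (y ∷ v) x≢ (here eq)  = x≢ zero eq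
    x∉ (y ∷ v) x≢ (there x∈) = x∉ v (x≢ ∘ suc) x∈

  hom⇒cycle : 2 ≤ k → (φ : Vec (Fin n) k) → Injective φ →
    (∀ i j → Adj (C k) i j → Adj G (Vec.lookup φ i) (Vec.lookup φ j)) → IsCycle (Vec.toList φ)
  hom⇒cycle (s≤s 1≤) (a ∷ v) inj hom = steps⇒walk a v
      (λ i j eq → hom i j (C-adj⁺ {i = i} {j} ((λ { refl → ℕ.1+n≢n eq }) , inj₁ (inj₁ eq))))
      (λ i eq → hom i zero (C-adj⁺ {i = i} {zero}
        ((λ { refl → contradiction (subst (1 ≤_) (sym eq) 1≤) λ () }) , inj₁ (inj₂ (cong suc eq , refl))))) ,
    toList-unique (a ∷ v) inj

∈-cycles : ∀ {a b k} → a ≤ k → k ≤ b → (k , C k) ∈ cycles a b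
∈-cycles {a} {b} {k} a≤k k≤b =
  subst (λ i → (i , C i) ∈ cycles a b) (ℕ.m+[n∸m]≡n a≤k)
    (∈-applyUpTo⁺ (λ i → a + i , C (a + i)) (ℕ.∸-monoˡ-< (s≤s k≤b) a≤k))

Forbidden : ℕ → ℕ → List (∃ Graph)
Forbidden l k = cycles 3 (2 * l ∸ 1) ++ [ 2 * k , C (2 * k) ]

ex-≤ : ∀ {h} {H : Graph h} {F : List (∃ Graph)} {b} →
  (∀ (G : Graph n) → Free F G → #copies H G ≤ b) → ex n H F ≤ b
ex-≤ {n} {H = H} {F} {b} bound = Extrema.max≤v⁺ z≤n (All.tabulate λ x∈ →
  let G , G∈ , x≡ = ∈-map⁻ (#copies H) x∈
  in subst (_≤ b) (sym x≡) (bound G (proj₂ (∈-filter⁻ (free? F) {xs = graphs n} G∈))))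

≤-ex : ∀ {h} {H : Graph h} {F : List (∃ Graph)} (G : Graph n) → Free F G → #copies H G ≤ ex n H F
≤-ex {n} {H = H} {F} G free = All.lookup (Extrema.xs≤max 0 (map (#copies H) (filter (free? F) (graphs n))))
  (∈-map⁺ (#copies H) (∈-filter⁺ (free? F) (∈-graphs G) free))

module Encoding {h : ℕ} (H : Graph h) (G : Graph n) where

  -- A copy is represented by the vertex list of one isomorphism, so it is counted once although it
  -- has several rootings. The empty list is a dummy value for subgraphs that are not copies.
  encode : Sub n → List (Fin n)
  encode S with isCopy? H G S
  ... | yes (_ , φ , _) = Vec.toList φ
  ... | no _            = []

  encode-copy : ∀ S → IsCopy H G S →
    IsSubgraphOf G S × ∃ λ φ → IsIso H S φ × encode S ≡ Vec.toList φ
  encode-copy S copy with isCopy? H G S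
  ... | yes (sub , φ , iso) = sub , φ , iso , refl
  ... | no ¬copy            = contradiction copy ¬copy

  copies : List (Sub n)
  copies = filter (isCopy? H G) (subs n)

  encode-injective : ∀ {S S′} → S ∈ copies → S′ ∈ copies → encode S ≡ encode S′ → S ≡ S′
  encode-injective {S} {S′} S∈ S′∈ eq
    with encode-copy S (proj₂ (∈-filter⁻ (isCopy? H G) {xs = subs n} S∈))
       | encode-copy S′ (proj₂ (∈-filter⁻ (isCopy? H G) {xs = subs n} S′∈))
  ... | sub , φ , iso , e | sub′ , φ′ , iso′ , e′
    with toList-injective {u = φ} {φ′} (trans (sym e) (trans eq e′))
  ... | refl = copy-determined {H = H} {G} {S} {S′} {φ} sub sub′ iso iso′

  encodings-unique : Unique (map encode copies)
  encodings-unique = Unique-map⁺ encode (Unique.filter⁺ (isCopy? H G) (subs-unique n)) encode-injective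

-- The upper bound

^-distrib-* : ∀ x y j → (x * y) ^ j ≡ x ^ j * y ^ j
^-distrib-* x y zero    = refl
^-distrib-* x y (suc j) = trans (cong (x * y *_) (^-distrib-* x y j))
  (solve 4 (λ x y u v → x :* y :* (u :* v) := (x :* u) :* (y :* v)) refl x y (x ^ j) (y ^ j))

length-2k : ∀ h e → 2 + (h + (h + e * 2)) ≡ 2 * (suc h + e)
length-2k = solve 2 (λ h e → con 2 :+ (h :+ (h :+ e :* con 2)) := con 2 :* (con 1 :+ h :+ e)) refl

cycles-bound-const : ∀ M n c j →
  (M * (n * ((n + n) * c) ^ j)) * c ≡ ((M * (2 * c) ^ j) * c) * n ^ suc j
cycles-bound-const M n c j = trans
  (cong (λ d → (M * (n * d)) * c) (trans
    (cong (_^ j) (solve 2 (λ n c → (n :+ n) :* c := (con 2 :* c) :* n) refl n c))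
    (^-distrib-* (2 * c) n j)))
  (solve 5 (λ M n c x y → (M :* (n :* (x :* y))) :* c := ((M :* x) :* c) :* (n :* y)) refl
    M n c ((2 * c) ^ j) (n ^ j))

module UpperBound (h′ e m′ N : ℕ) (N≡ : N ≡ suc (suc m′) * suc (suc h′)) where

  -- The factors of `K₀`: `suc N` shifts, `2 * c` for each of the `suc m′` blocks of a complement,
  -- and `c` bearers per removed label.
  h l c K₀ : ℕ
  h = suc h′
  l = suc h
  c = h + e * 2
  K₀ = (suc N * (2 * c) ^ suc m′) * c

  #copies-bound : (G : Graph n) → Free (Forbidden l (l + e)) G →
    #copies (C N) G ≤ K₀ * n ^ suc (suc m′)
  #copies-bound {n} G free = ℕ.≤-trans
    (ℕ.≤-reflexive (sym (List.length-map encode copies)))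
    (ℕ.≤-trans (cycles-bound m′ (map encode copies) encodings-unique (λ u∈ → let cyc , len = good u∈ in cyc , trans len N≡))
      (ℕ.≤-reflexive (trans (cong₂ (λ N s → (suc N * (s * ((s + s) * c) ^ suc m′)) * c) (sym N≡) (List.length-tabulate {n = n} id))
        (cycles-bound-const (suc N) n c (suc m′)))))
    where
    open ListCycles G
    open Encoding (C N) G
    girth : GirthAtLeast (2 + (h + h))
    girth xs cyc 3≤ (s≤s short) = All.lookup free
      (∈-++⁺ˡ (∈-cycles 3≤ (ℕ.≤-trans short (ℕ.≤-reflexive
        (trans (sym (ℕ.+-suc h h)) (cong (λ i → h + suc i) (sym (ℕ.+-identityʳ h))))))))
      (cycle⇒contains xs cyc)
    no-2k : NoCycleOfLength (2 + (h + (h + e * 2)))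
    no-2k xs cyc len = All.lookup free (∈-++⁺ʳ (cycles 3 (2 * l ∸ 1)) (here refl))
      (subst (λ i → Contains G (C i)) (trans len (length-2k h e)) (cycle⇒contains xs cyc))
    open Blocks Fin._≟_ {Adj G} (adj? G) (adj-sym G) h′ e girth no-2k
      (allFin n) (Unique.allFin⁺ n) ∈-allFin using (cycles-bound)
    2≤N : 2 ≤ N
    2≤N = ℕ.≤-trans (s≤s (s≤s z≤n)) (ℕ.≤-reflexive (sym N≡))
    good : ∀ {u} → u ∈ map encode copies → IsCycle u × length u ≡ N
    good u∈ with ∈-map⁻ encode u∈
    ... | S , S∈ , refl with encode-copy S (proj₂ (∈-filter⁻ (isCopy? (C N) G) {xs = subs n} S∈))
    ... | sub , φ , (inj , _ , _ , hom , _) , eq =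
      subst (λ u → IsCycle u × length u ≡ N) (sym eq)
        (hom⇒cycle 2≤N φ inj (λ i j ij → proj₁ (sub _ _ (hom i j ij))) , Vec.length-toList φ)

  ex-bound : ∀ n → ex n (C N) (Forbidden l (l + e)) ≤ K₀ * n ^ suc (suc m′)
  ex-bound n = ex-≤ {n} {H = C N} {Forbidden l (l + e)} #copies-bound

-- Closed walks in a circular ladder

module Mod (d : ℕ) .{{_ : NonZero d}} where

  infix 4 _≈_
  _≈_ : ℕ → ℕ → Set
  a ≈ b = a % d ≡ b % d

  ≈-+ : ∀ {a b} i {j} → a ≈ b → i ≈ j → a + i ≈ b + j
  ≈-+ {a} {b} i {j} p q = trans (%-distribˡ-+ a i d)
    (trans (cong (_% d) (cong₂ _+_ p q)) (sym (%-distribˡ-+ b j d)))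

  ≈-* : ∀ {a b} i → a ≈ b → a * i ≈ b * i
  ≈-* {a} {b} i p = trans (%-distribˡ-* a i d)
    (trans (cong (λ r → (r * (i % d)) % d) p) (sym (%-distribˡ-* b i d)))

  -- Adding a * d ∸ a to both sides removes a.
  ≈-cancel : ∀ a i → a + i ≈ a → d ∣ i
  ≈-cancel a i p = m%n≡0⇒n∣m i d (trans (sym ([m+kn]%n≡m%n i a d))
    (trans (cong (_% d) shuffle) (trans (≈-+ c p refl) (trans (cong (_% d) a+c) (m*n%n≡0 a d)))))
    where
    c = a * d ∸ a
    a+c : a + c ≡ a * d
    a+c = ℕ.m+[n∸m]≡n (ℕ.m≤m*n a d)
    shuffle : i + a * d ≡ a + i + c
    shuffle = trans (cong (i +_) (sym a+c)) (trans (sym (ℕ.+-assoc i a c)) (cong (_+ c) (ℕ.+-comm i a)))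

-- M is the number of levels; the hubs are the vertices on the levels divisible by l.
module Ladder {V : Set} (M l : ℕ) .{{_ : NonZero M}} .{{_ : NonZero l}} (l∣M : l ∣ M) (l<M : l < M)
  (level : V → ℕ) (level<M : ∀ v → level v < M)
  {U : V → V → Set} (U? : ∀ u v → Dec (U u v))
  (U-level : ∀ u v → U u v → Mod._≈_ M (suc (level u)) (level v))
  (up-unique : ∀ u a b → ¬ (l ∣ level u) → U u a → U u b → a ≡ b)
  (down-unique : ∀ u a b → ¬ (l ∣ level u) → U a u → U b u → a ≡ b)
  (hub-unique : ∀ u v u′ v′ → U u u′ ⊎ U u′ u → U v v′ ⊎ U v′ v → l ∣ level u → level u ≡ level v → u ≡ v)
  where

  open Mod M

  Hub : V → Set
  Hub v = l ∣ level v

  level-≈ : ∀ {u v} → level u ≈ level v → level u ≡ level v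
  level-≈ {u} {v} p = trans (sym (m<n⇒m%n≡m (level<M u))) (trans p (m<n⇒m%n≡m (level<M v)))

  -- After a start upwards from a hub, the next `l ∸ 1` vertices are not hubs, as `l` does not
  -- divide their levels (reduction modulo `M` respects this by `l∣M`). At such a vertex
  -- `down-unique` turns a step down into a step back, which is excluded.
  run : (y : ℕ → V) → (∀ i → U (y i) (y (suc i)) ⊎ U (y (suc i)) (y i)) → (∀ i → y (suc (suc i)) ≢ y i) →
    Hub (y 0) → U (y 0) (y 1) → ∀ j → j < l →
    U (y j) (y (suc j)) × level (y (suc j)) ≈ level (y 0) + suc j
  run y step noBack hub up zero    j<l = up ,
    trans (sym (U-level _ _ up)) (cong (_% M) (ℕ.+-comm 1 (level (y 0))))
  run y step noBack hub up (suc j) j<l with run y step noBack hub up j (ℕ.<-trans ℕ.≤-refl j<l)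
  ... | up-j , lev = up-j+1 , trans (sym (U-level _ _ up-j+1))
          (trans (≈-+ {1} {1} (level (y (suc j))) refl lev) (cong (_% M) (sym (ℕ.+-suc (level (y 0)) (suc j)))))
    where
    ¬hub : ¬ Hub (y (suc j))
    ¬hub h = ℕ.<⇒≱ j<l (∣⇒≤ (∣m+n∣m⇒∣n
      (∣n∣m%n⇒∣m l∣M (subst (l ∣_) lev (%-presˡ-∣ h l∣M))) hub))
    up-j+1 : U (y (suc j)) (y (suc (suc j)))
    up-j+1 with step (suc j)
    ... | inj₁ u = u
    ... | inj₂ d = contradiction (down-unique _ _ _ ¬hub d up-j) (noBack j)

  -- A closed walk of length L without repetition, traversed for ever.
  module _ (L : ℕ) .{{_ : NonZero L}} where

    record Cyclic (x : ℕ → V) : Set where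
      field
        periodic  : ∀ {i j} → Mod._≈_ L i j → x i ≡ x j
        injective : ∀ {i j} → x i ≡ x j → Mod._≈_ L i j
        step      : ∀ i → U (x i) (x (suc i)) ⊎ U (x (suc i)) (x i)

  module _ (p : ℕ) (2≤p : 2 ≤ p) where

    L : ℕ
    L = suc p

    module ModL = Mod L

    open Cyclic

    0≈L : ∀ i → i + L ModL.≈ i
    0≈L i = [m+n]%n≡m%n i L

    module _ {x : ℕ → V} (X : Cyclic L x) where

      noBack : ∀ i → x (suc (suc i)) ≢ x i
      noBack i eq = ℕ.<⇒≱ (s≤s 2≤p) (∣⇒≤ (ModL.≈-cancel i 2
        (trans (cong (_% L) (ℕ.+-comm i 2)) (injective X eq))))

      period : ∀ i → x (i + L) ≡ x i
      period i = periodic X (0≈L i)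

    -- Modulo `L`, multiplication by `p` is negation, so this runs the closed walk backwards without
    -- subtraction.
    reversed : (ℕ → V) → ℕ → V
    reversed x i = x (i * p)

    forth-back : ∀ i → suc (p + i * p) ModL.≈ i * p
    forth-back i = trans (cong (_% L) (ℕ.+-comm L (i * p))) (0≈L (i * p))

    reversed-cyclic : ∀ {x} → Cyclic L x → Cyclic L (reversed x)
    reversed-cyclic {x} X = record
      { periodic  = λ {i} {j} i≈j → periodic X (ModL.≈-* {i} {j} p i≈j)
      ; injective = λ {i} {j} eq → unmultiply i j (injective X eq)
      ; step      = step′ }
      where
      -- p ≈ -1
      kill : ∀ i j → i * p + (i + j) ModL.≈ j
      kill i j = trans (cong (_% L) (solve 3 (λ i j p → i :* p :+ (i :+ j) := j :+ i :* (con 1 :+ p)) refl i j p))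
        ([m+kn]%n≡m%n j i L)
      unmultiply : ∀ i j → i * p ModL.≈ j * p → i ModL.≈ j
      unmultiply i j eq = trans (sym (kill j i)) (trans (cong (_% L) (cong (j * p +_) (ℕ.+-comm j i)))
        (trans (ModL.≈-+ {j * p} {i * p} (i + j) (sym eq) refl) (kill i j)))
      step′ : ∀ i → U (x (i * p)) (x (p + i * p)) ⊎ U (x (p + i * p)) (x (i * p))
      step′ i with step X (p + i * p)
      ... | inj₁ u = inj₂ (subst (U _) (periodic X (forth-back i)) u)
      ... | inj₂ u = inj₁ (subst (λ v → U v (x (p + i * p))) (periodic X (forth-back i)) u)

    -- Each step raises the level by one, so returning after `L` steps gives `M ∣ L`. Conversely,
    -- `M` steps after a hub the walk is at a hub of the same level, hence at the same vertex, and
    -- `L ∣ M`.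
    rising⇒length : ∀ {x} → Cyclic L x → (∀ i → U (x i) (x (suc i))) → L ≡ M
    rising⇒length {x} X up = ∣-antisym
        (ModL.≈-cancel τ M (injective X (sym (hub-unique _ _ _ _ (inj₁ (up τ)) (inj₁ (up (τ + M))) hub
          (level-≈ (sym (trans (rise τ M) ([m+n]%n≡m%n (level (x τ)) M))))))))
        (≈-cancel (level (x 0)) L (trans (sym (rise 0 L)) (cong (λ v → level v % M) (period X 0))))
      where
      rise : ∀ i j → level (x (i + j)) ≈ level (x i) + j
      rise i zero    = cong (_% M) (trans (cong (level ∘ x) (ℕ.+-identityʳ i)) (sym (ℕ.+-identityʳ _)))
      rise i (suc j) = trans (cong (λ a → level (x a) % M) (ℕ.+-suc i j))
        (trans (sym (U-level _ _ (up (i + j)))) (trans (≈-+ {1} {1} (level (x (i + j))) refl (rise i j))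
          (cong (_% M) (sym (ℕ.+-suc (level (x i)) j)))))
      -- After `τ` steps the walk is on level 0, which carries a hub.
      τ = M ∸ level (x 0)
      hub : Hub (x τ)
      hub = ∣n∣m%n⇒∣m l∣M (subst (l ∣_) (sym (trans (rise 0 τ)
        (trans (cong (_% M) (ℕ.m+[n∸m]≡n (ℕ.<⇒≤ (level<M (x 0))))) (n%n≡0 M)))) (l ∣0))

    -- By `up-unique` a valley is a hub. From it both branches, forwards (`y`) and backwards (`ȳ`),
    -- rise for `l` steps to a hub of the same level, so they meet there. This gives `L ∣ 2 * l`,
    -- and `l < L` leaves only equality.
    valley⇒length : ∀ {x} → Cyclic L x → ∀ τ → U (x (suc τ)) (x τ) → U (x (suc τ)) (x (suc (suc τ))) →
      L ≡ 2 * l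
    valley⇒length {x} X τ down up = result
      where
      σ = suc τ
      X̄ = reversed-cyclic X
      hub : Hub (x σ)
      hub with l ∣? level (x σ)
      ... | yes h = h
      ... | no ¬h = contradiction (up-unique _ _ _ ¬h up down) (noBack X τ)
      y ȳ : ℕ → V
      y i = x (i + σ)
      ȳ i = x (i * p + σ)
      y-run : ∀ j → j < l → U (y j) (y (suc j)) × level (y (suc j)) ≈ level (y 0) + suc j
      y-run = run y (λ i → step X (i + σ)) (λ i → noBack X (i + σ)) hub up
      back : ∀ i → suc (p + i * p + σ) ModL.≈ i * p + σ
      back i = ModL.≈-+ {suc (p + i * p)} {i * p} σ (forth-back i) refl
      ȳ-step : ∀ i → U (ȳ i) (ȳ (suc i)) ⊎ U (ȳ (suc i)) (ȳ i)
      ȳ-step i with step X (p + i * p + σ)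
      ... | inj₁ u = inj₂ (subst (U _) (periodic X (back i)) u)
      ... | inj₂ u = inj₁ (subst (λ v → U v (ȳ (suc i))) (periodic X (back i)) u)
      ȳ-noBack : ∀ i → ȳ (suc (suc i)) ≢ ȳ i
      ȳ-noBack i eq = noBack X (p + (p + i * p) + σ) (trans
        (periodic X (trans (cong (_% L) (solve 3 (λ p a σ → con 2 :+ (p :+ (p :+ a) :+ σ) := (a :+ σ) :+ con 2 :* (con 1 :+ p))
          refl p (i * p) σ)) ([m+kn]%n≡m%n (i * p + σ) 2 L)))
        (sym eq))
      ȳ-run : ∀ j → j < l → U (ȳ j) (ȳ (suc j)) × level (ȳ (suc j)) ≈ level (ȳ 0) + suc j
      ȳ-run = run ȳ ȳ-step ȳ-noBack hub (subst (U (x σ)) (periodic X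
        (trans (sym (0≈L τ)) (cong (_% L) (solve 2 (λ τ p → τ :+ (con 1 :+ p) := (p :+ con 0) :+ (con 1 :+ τ)) refl τ p)))) down)
      j = l ∸ 1
      sj≡l : suc j ≡ l
      sj≡l = ℕ.m+[n∸m]≡n (>-nonZero⁻¹ l)
      j<l : j < l
      j<l = ℕ.≤-reflexive sj≡l
      hub′ : Hub (y (suc j))
      hub′ = ∣n∣m%n⇒∣m l∣M (subst (l ∣_) (sym (proj₂ (y-run j j<l)))
        (%-presˡ-∣ (∣m∣n⇒∣m+n hub (subst (l ∣_) (sym sj≡l) ∣-refl)) l∣M))
      meet : y (suc j) ≡ ȳ (suc j)
      meet = hub-unique _ _ _ _ (inj₂ (proj₁ (y-run j j<l))) (inj₂ (proj₁ (ȳ-run j j<l))) hub′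
        (level-≈ (trans (proj₂ (y-run j j<l)) (sym (proj₂ (ȳ-run j j<l)))))
      -- As `l * p` is `- l` modulo `L`, the meeting says that `σ + l` and `σ - l` agree modulo `L`.
      L∣2l : L ∣ 2 * l
      L∣2l = ModL.≈-cancel σ (2 * l) (trans
        (cong (_% L) (solve 2 (λ σ l → σ :+ con 2 :* l := (l :+ σ) :+ l) refl σ l))
        (trans (ModL.≈-+ {l + σ} {l * p + σ} l (injective X (subst (λ i → x (i + σ) ≡ x (i * p + σ)) sj≡l meet)) refl)
          (trans (cong (_% L) (solve 3 (λ σ l p → (l :* p :+ σ) :+ l := σ :+ l :* (con 1 :+ p)) refl σ l p))
            ([m+kn]%n≡m%n σ l L))))
      -- If `L ≤ l`, the walk would close up while still rising, so `M` would divide `L`, against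
      -- `l<M`.
      l<L : l < L
      l<L = ℕ.≰⇒> λ L≤l → ℕ.<⇒≱ l<M (ℕ.≤-trans (∣⇒≤ (≈-cancel (level (x σ)) L
        (trans (sym (proj₂ (y-run p L≤l))) (cong (λ v → level v % M)
          (trans (cong x (ℕ.+-comm L σ)) (period X σ)))))) L≤l)
      result : L ≡ 2 * l
      result with L∣2l
      ... | divides zero eq = contradiction (ℕ.m+n≡0⇒m≡0 l eq) (≢-nonZero⁻¹ l)
      ... | divides (suc zero) eq = sym (trans eq (ℕ.+-identityʳ L))
      ... | divides (suc (suc q)) eq = contradiction
        (ℕ.<-≤-trans (ℕ.*-monoʳ-< 2 l<L) (ℕ.*-monoˡ-≤ L (s≤s (s≤s (z≤n {q})))))
        (ℕ.<-irrefl eq)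

    -- Between a descent and a later ascent, the first step that goes up follows a descent.
    findValley : ∀ {x} → Cyclic L x → ∀ d i → U (x (suc i)) (x i) →
      U (x (suc (i + d))) (x (suc (suc (i + d)))) →
      ∃ λ τ → U (x (suc τ)) (x τ) × U (x (suc τ)) (x (suc (suc τ)))
    findValley {x} X zero    i down up = i , down ,
      subst (λ j → U (x (suc j)) (x (suc (suc j)))) (ℕ.+-identityʳ i) up
    findValley {x} X (suc d) i down up with step X (suc i)
    ... | inj₁ u = i , down , u
    ... | inj₂ u = findValley X d (suc i) u
      (subst (λ j → U (x (suc j)) (x (suc (suc j)))) (ℕ.+-suc i d) up)

    cyclic⇒length : ∀ {x} → Cyclic L x → L ≡ M ⊎ L ≡ 2 * l
    cyclic⇒length {x} X with ℕ.anyUpTo? (λ i → ¬? (U? (x i) (x (suc i)))) L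
    ... | no ∄ = inj₁ (rising⇒length X up)
      where
      up : ∀ i → U (x i) (x (suc i))
      up i with U? (x (i % L)) (x (suc (i % L)))
      ... | yes u = subst₂ U (periodic X (m%n%n≡m%n i L))
                      (periodic X (ModL.≈-+ {1} {1} (i % L) refl (m%n%n≡m%n i L))) u
      ... | no ¬u = contradiction (i % L , m%n<n i L , ¬u) ∄
    ... | yes (i , i<L , ¬up) with ℕ.anyUpTo? (λ i → ¬? (U? (x (suc i)) (x i))) L
    ...   | no ∄ = inj₁ (rising⇒length (reversed-cyclic X) λ i →
              subst (λ v → U v (x (p + i * p))) (periodic X (forth-back i)) (down (p + i * p)))
      where
      down : ∀ i → U (x (suc i)) (x i)
      down i with U? (x (suc (i % L))) (x (i % L))
      ... | yes u = subst₂ U (periodic X (ModL.≈-+ {1} {1} (i % L) refl (m%n%n≡m%n i L)))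
                      (periodic X (m%n%n≡m%n i L)) u
      ... | no ¬u = contradiction (i % L , m%n<n i L , ¬u) ∄
    ...   | yes (j , _ , ¬down) with step X i | step X j
    ...     | inj₁ u | _      = contradiction u ¬up
    ...     | inj₂ _ | inj₂ d = contradiction d ¬down
    ...     | inj₂ d | inj₁ u =
      -- The ascent at `j` may come before the descent at `i`; its translate by one period, at
      -- `j + L`, comes after it because `i < L`.
      let τ , down , up = findValley X (j + L ∸ suc i) i d
            (subst₂ U (periodic X (sym (trans (cong (_% L) idx) (0≈L j))))
              (periodic X (sym (trans (cong (λ a → suc a % L) idx) (0≈L (suc j))))) u)
      in inj₂ (valley⇒length X τ down up)
      where
      idx : suc (i + (j + L ∸ suc i)) ≡ j + L
      idx = ℕ.m+[n∸m]≡n (ℕ.≤-trans i<L (ℕ.m≤n+m L j))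

-- The lower bound

module Image {h : ℕ} (H : Graph h) (φ : Vec (Fin n) h) (φ-injective : Injective φ) where

  inImage? : ∀ v → Dec (∃ λ i → Vec.lookup φ i ≡ v)
  inImage? v = Fin.any? λ i → Vec.lookup φ i Fin.≟ v

  vertices : Subset n
  vertices = Vec.tabulate (does ∘ inImage?)

  ∈-vertices⁺ : ∀ i → Vec.lookup φ i Subset.∈ vertices
  ∈-vertices⁺ i with inImage? (Vec.lookup φ i) | Vec.lookup∘tabulate (does ∘ inImage?) (Vec.lookup φ i)
  ... | yes _ | eq = Vec.lookup⇒[]= _ vertices eq
  ... | no ∄  | _  = contradiction (i , refl) ∄

  ∈-vertices⁻ : ∀ {v} → v Subset.∈ vertices → ∃ λ i → Vec.lookup φ i ≡ v
  ∈-vertices⁻ {v} v∈ with inImage? v | trans (sym (Vec.lookup∘tabulate (does ∘ inImage?) v)) (Vec.[]=⇒lookup v∈)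
  ... | yes im | _ = im

  Edge : Rel (Fin n) 0ℓ
  Edge u v = ∃₂ λ i j → Vec.lookup φ i ≡ u × Vec.lookup φ j ≡ v × Adj H i j

  edge? : B.Decidable Edge
  edge? u v = Fin.any? λ i → Fin.any? λ j →
    (Vec.lookup φ i Fin.≟ u) ×-dec ((Vec.lookup φ j Fin.≟ v) ×-dec adj? H i j)

  edge-irrefl : ∀ v → ¬ Edge v v
  edge-irrefl v (i , j , refl , eq , ij) with φ-injective i j (sym eq)
  ... | refl = adj-irrefl H i ij

  image : Sub n
  image = vertices , fromRel edge? edge-irrefl λ { u v (i , j , p , q , ij) → j , i , q , p , adj-sym H ij }

  image-copy : (G : Graph n) → (∀ i j → Adj H i j → Adj G (Vec.lookup φ i) (Vec.lookup φ j)) →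
    IsCopy H G image
  image-copy G hom =
    (λ u v uv → sub u v (∈-matrix⁻ edge? uv)) ,
    φ , φ-injective , ∈-vertices⁺ , (λ v → ∈-vertices⁻) ,
    (λ i j ij → ∈-matrix⁺ edge? (i , j , refl , refl , ij)) ,
    λ i j ij → reflect i j (∈-matrix⁻ edge? ij)
    where
    sub : ∀ u v → Edge u v → Adj G u v × u Subset.∈ vertices × v Subset.∈ vertices
    sub u v (i , j , refl , refl , ij) = hom i j ij , ∈-vertices⁺ i , ∈-vertices⁺ j
    reflect : ∀ i j → Edge (Vec.lookup φ i) (Vec.lookup φ j) → Adj H i j
    reflect i j (i′ , j′ , p , q , ij) with φ-injective i′ i p | φ-injective j′ j q
    ... | refl | refl = ij

image-⊆ : ∀ {h} (H : Graph h) (φ ψ : Vec (Fin n) h) (φ-inj : Injective φ) (ψ-inj : Injective ψ) →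
  Image.image H φ φ-inj ≡ Image.image H ψ ψ-inj → ∀ i → ∃ λ j → Vec.lookup ψ j ≡ Vec.lookup φ i
image-⊆ H φ ψ φ-inj ψ-inj eq i = Image.∈-vertices⁻ H ψ ψ-inj
  (subst (λ S → Vec.lookup φ i Subset.∈ proj₁ S) eq (Image.∈-vertices⁺ H φ φ-inj i))

≤-#copies : ∀ {h} (H : Graph h) (G : Graph n) (f : X → Sub n) → (∀ {x y} → f x ≡ f y → x ≡ y) →
  (∀ x → IsCopy H G (f x)) → {xs : List X} → Unique xs → length xs ≤ #copies H G
≤-#copies {n} H G f f-inj copy {xs} u = ℕ.≤-trans (ℕ.≤-reflexive (sym (List.length-map f xs)))
  (Unique-⊆⇒length≤ (Unique.map⁺ f-inj u) sub)
  where
  sub : map f xs ⊆ filter (isCopy? H G) (subs n)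
  sub S∈ with ∈-map⁻ f S∈
  ... | x , _ , refl = ∈-filter⁺ (isCopy? H G) (∈-subs (f x)) (copy x)

length-vectors-allFin : ∀ t k → length (vectors (allFin t) k) ≡ t ^ k
length-vectors-allFin t zero    = refl
length-vectors-allFin t (suc k) = trans (length-cartesianProductWith _∷_ (allFin t) (vectors (allFin t) k))
  (cong₂ _*_ (List.length-tabulate {n = t} id) (length-vectors-allFin t k))

-- The quotient of a level by `l` numbers the gap between consecutive hubs; inside a gap it does not
-- change, and so the chosen strand does not change either.
suc-/ : ∀ i l .{{_ : NonZero l}} → ¬ (l ∣ suc i) → suc i / l ≡ i / l
suc-/ i l ∤ = trans (cong (_/ l) (cong suc (m≡m%n+[m/n]*n i l)))
  (trans (+-distrib-/-∣ʳ (suc (i % l)) (n∣m*n (i / l)))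
    (cong₂ _+_ (m<n⇒m/n≡0 r<l) (m*n/n≡m (i / l) l)))
  where
  r<l : suc (i % l) < l
  r<l = ℕ.≤∧≢⇒< (m%n<n i l) λ eq → ∤ (divides (suc (i / l))
    (trans (cong suc (m≡m%n+[m/n]*n i l)) (cong (_+ (i / l) * l) eq)))

-- The vertex number level + strand * M; on a level divisible by l only the vertex of strand 0
-- (a hub) is used, and consecutive hubs are joined by one path of length l in each strand.
module LadderGraph (n m l : ℕ) (2≤l : 2 ≤ l) (2≤m : 2 ≤ m)
  .{{_ : NonZero l}} .{{_ : NonZero (m * l)}} where

  M : ℕ
  M = m * l

  open Mod M

  l∣M : l ∣ M
  l∣M = n∣m*n m

  2l≤M : 2 * l ≤ M
  2l≤M = ℕ.*-monoˡ-≤ l 2≤m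

  l<2l : l < 2 * l
  l<2l = ℕ.m<m+n l (ℕ.≤-trans (s≤s z≤n) (ℕ.≤-trans 2≤l (ℕ.m≤m+n l 0)))

  l<M : l < M
  l<M = ℕ.<-≤-trans l<2l 2l≤M

  level strand : Fin n → ℕ
  level  v = toℕ v % M
  strand v = toℕ v / M

  vertex-ext : ∀ {u v} → level u ≡ level v → strand u ≡ strand v → u ≡ v
  vertex-ext {u} {v} p q = Fin.toℕ-injective (trans (m≡m%n+[m/n]*n (toℕ u) M)
    (trans (cong₂ (λ r s → r + s * M) p q) (sym (m≡m%n+[m/n]*n (toℕ v) M))))

  Hub Valid : Fin n → Set
  Hub v   = l ∣ level v
  Valid v = Hub v → strand v ≡ 0

  -- The strand may change only at a hub, which has strand 0 and belongs to all strands. The other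
  -- vertices on hub levels are not `Valid` and stay isolated.
  U : Fin n → Fin n → Set
  U u v = (Valid u × Valid v) × (suc (level u) % M ≡ level v) ×
    (strand u ≡ strand v ⊎ (Hub u ⊎ Hub v))

  valid? : ∀ v → Dec (Valid v)
  valid? v = (l ∣? level v) →-dec (strand v ℕ.≟ 0)

  U? : ∀ u v → Dec (U u v)
  U? u v = (valid? u ×-dec valid? v) ×-dec ((suc (level u) % M ℕ.≟ level v) ×-dec
    ((strand u ℕ.≟ strand v) ⊎-dec ((l ∣? level u) ⊎-dec (l ∣? level v))))

  U-level : ∀ u v → U u v → suc (level u) ≈ level v
  U-level u v (_ , eq , _) = trans eq (sym (m%n%n≡m%n (toℕ v) M))

  same-strand : ∀ {u a b} → ¬ Hub u → Valid a → Valid b → level a ≡ level b →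
    strand u ≡ strand a ⊎ Hub a → strand u ≡ strand b ⊎ Hub b → a ≡ b
  same-strand {u} {a} {b} ¬hub va vb lev sa sb = vertex-ext lev (strands sa sb)
    where
    strands : strand u ≡ strand a ⊎ Hub a → strand u ≡ strand b ⊎ Hub b → strand a ≡ strand b
    strands (inj₁ p) (inj₁ q) = trans (sym p) q
    strands (inj₂ h) _ = trans (va h) (sym (vb (subst (l ∣_) lev h)))
    strands _ (inj₂ h) = trans (va (subst (l ∣_) (sym lev) h)) (sym (vb h))

  notFirst : ∀ {A B C : Set} → ¬ B → A ⊎ (B ⊎ C) → A ⊎ C
  notFirst ¬b (inj₁ a) = inj₁ a
  notFirst ¬b (inj₂ (inj₁ b)) = contradiction b ¬b
  notFirst ¬b (inj₂ (inj₂ c)) = inj₂ c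

  notSecond : ∀ {A B C : Set} → ¬ C → A ⊎ (B ⊎ C) → A ⊎ B
  notSecond ¬c (inj₁ a) = inj₁ a
  notSecond ¬c (inj₂ (inj₁ b)) = inj₂ b
  notSecond ¬c (inj₂ (inj₂ c)) = contradiction c ¬c

  up-unique : ∀ u a b → ¬ Hub u → U u a → U u b → a ≡ b
  up-unique u _ _ ¬hub ((_ , va) , la , sa) ((_ , vb) , lb , sb) =
    same-strand {u} ¬hub va vb (trans (sym la) lb) (notFirst ¬hub sa) (notFirst ¬hub sb)

  level-% : ∀ v → level v % M ≡ level v
  level-% v = m%n%n≡m%n (toℕ v) M

  suc-level-cancel : ∀ {a b} → suc (level a) ≈ suc (level b) → level a ≡ level b
  suc-level-cancel {a} {b} eq = trans (sym (level-% a)) (trans (sym (wrap (level a)))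
    (trans (≈-+ {suc (level a)} {suc (level b)} (M ∸ 1) eq refl) (trans (wrap (level b)) (level-% b))))
    where
    wrap : ∀ i → suc i + (M ∸ 1) ≈ i
    wrap i = trans (cong (_% M) (trans (sym (ℕ.+-suc i (M ∸ 1)))
      (cong (i +_) (ℕ.m+[n∸m]≡n (ℕ.≤-trans (s≤s z≤n) l<M))))) ([m+n]%n≡m%n i M)

  down-unique : ∀ u a b → ¬ Hub u → U a u → U b u → a ≡ b
  down-unique u a b ¬hub ((va , _) , la , sa) ((vb , _) , lb , sb) =
    same-strand {u} ¬hub va vb (suc-level-cancel (trans la (sym lb)))
      (flipped (notSecond ¬hub sa)) (flipped (notSecond ¬hub sb))
    where
    flipped : ∀ {a} → strand a ≡ strand u ⊎ Hub a → strand u ≡ strand a ⊎ Hub a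
    flipped (inj₁ p) = inj₁ (sym p)
    flipped (inj₂ h) = inj₂ h

  -- An incident edge makes a vertex `Valid`, and a `Valid` hub has strand 0, so its level
  -- determines it.
  hub-unique : ∀ u v u′ v′ → U u u′ ⊎ U u′ u → U v v′ ⊎ U v′ v → Hub u → level u ≡ level v → u ≡ v
  hub-unique _ _ _ _ eu ev h lev = vertex-ext lev (trans (valid eu h) (sym (valid ev (subst (l ∣_) lev h))))
    where
    valid : ∀ {u u′} → U u u′ ⊎ U u′ u → Valid u
    valid (inj₁ ((v , _) , _)) = v
    valid (inj₂ ((_ , v) , _)) = v

  U-irrefl : ∀ v → ¬ U v v
  U-irrefl v e = ℕ.<⇒≱ (ℕ.<-≤-trans 2≤l (ℕ.<⇒≤ l<M)) (∣⇒≤ (≈-cancel (level v) 1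
    (trans (cong (_% M) (ℕ.+-comm (level v) 1)) (U-level v v e))))

  edge? : B.Decidable (λ u v → U u v ⊎ U v u)
  edge? u v = U? u v ⊎-dec U? v u

  ladder : Graph n
  ladder = fromRel edge? (λ v → [ U-irrefl v , U-irrefl v ]′) (λ u v → Sum.swap)

  level<M : ∀ v → level v < M
  level<M v = m%n<n (toℕ v) M

  open Ladder {Fin n} M l l∣M l<M level level<M {U} U? U-level up-unique down-unique hub-unique
    using (cyclic⇒length)

  module _ (p : ℕ) (2≤p : 2 ≤ p) where

    L : ℕ
    L = suc p

    module ModL = Mod L

    mod-next : ∀ i → Next (i mod L) (suc i mod L)
    mod-next i with suc (i % L) ℕ.≟ L
    ... | yes eq = inj₂ (trans (cong suc (Fin.toℕ-fromℕ< (m%n<n i L))) eq ,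
        trans (Fin.toℕ-fromℕ< (m%n<n (suc i) L)) (trans (sym carry) (trans (cong (_% L) eq) (n%n≡0 L))))
      where
      carry : suc (i % L) ModL.≈ suc i
      carry = ModL.≈-+ {1} {1} (i % L) refl (m%n%n≡m%n i L)
    ... | no ≢L = inj₁ (trans (cong suc (Fin.toℕ-fromℕ< (m%n<n i L)))
        (trans (sym (m<n⇒m%n≡m (ℕ.≤∧≢⇒< (m%n<n i L) ≢L)))
          (trans (ModL.≈-+ {1} {1} (i % L) refl (m%n%n≡m%n i L)) (sym (Fin.toℕ-fromℕ< (m%n<n (suc i) L))))))

    mod⇒≈ : ∀ {i j} → i mod L ≡ j mod L → i ModL.≈ j
    mod⇒≈ {i} {j} eq = trans (sym (Fin.toℕ-fromℕ< (m%n<n i L)))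
      (trans (cong toℕ eq) (Fin.toℕ-fromℕ< (m%n<n j L)))

    -- Composing the embedding with reduction modulo `L` gives a closed walk traversed for ever, to
    -- which `cyclic⇒length` applies.
    contains⇒length : Contains ladder (C L) → L ≡ M ⊎ L ≡ 2 * l
    contains⇒length (φ , inj , hom) = cyclic⇒length p 2≤p {x = λ i → Vec.lookup φ (i mod L)} (record
      { periodic  = λ {i} {j} eq → cong (Vec.lookup φ) (Fin.fromℕ<-cong _ _ eq (m%n<n i L) (m%n<n j L))
      ; injective = λ {i} {j} eq → mod⇒≈ {i} {j} (inj (i mod L) (j mod L) eq)
      ; step      = λ i → ∈-matrix⁻ edge? (hom (i mod L) (suc i mod L)
          (C-adj⁺ {k = L} {i mod L} {suc i mod L} (distinct i , inj₁ (mod-next i)))) })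
      where
      distinct : ∀ i → i mod L ≢ suc i mod L
      distinct i eq = ℕ.<⇒≱ (s≤s (ℕ.≤-trans (s≤s z≤n) 2≤p)) (∣⇒≤ (ModL.≈-cancel i 1
        (trans (cong (_% L) (ℕ.+-comm i 1)) (sym (mod⇒≈ {i} {suc i} eq)))))

  module Strands (t : ℕ) (0<t : 0 < t) (t*M≤n : t * M ≤ n) where

    index<m : (i : Fin M) → toℕ i / l < m
    index<m i = m<n*o⇒m/o<n (Fin.toℕ<n i)

    -- `f` picks one strand for each of the `m` gaps; levels of hubs are sent to strand 0.
    choice : Vec (Fin t) m → Fin M → Fin t
    choice f i with l ∣? toℕ i
    ... | yes _ = Fin.fromℕ< 0<t
    ... | no _  = Vec.lookup f (Fin.fromℕ< (index<m i))

    choice-hub : ∀ f i → l ∣ toℕ i → toℕ (choice f i) ≡ 0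
    choice-hub f i h with l ∣? toℕ i
    ... | yes _ = Fin.toℕ-fromℕ< 0<t
    ... | no ¬h = contradiction h ¬h

    choice-inner : ∀ f i q → ¬ (l ∣ toℕ i) → toℕ i / l ≡ toℕ q → choice f i ≡ Vec.lookup f q
    choice-inner f i q ¬h eq with l ∣? toℕ i
    ... | yes h = contradiction h ¬h
    ... | no _  = cong (Vec.lookup f) (Fin.toℕ-injective (trans (Fin.toℕ-fromℕ< (index<m i)) eq))

    vertex< : ∀ (i : Fin M) (s : Fin t) → toℕ i + toℕ s * M < n
    vertex< i s = ℕ.<-≤-trans (ℕ.+-monoˡ-< (toℕ s * M) (Fin.toℕ<n i))
      (ℕ.≤-trans (ℕ.*-monoˡ-≤ M (Fin.toℕ<n s)) t*M≤n)

    vertex : Vec (Fin t) m → Fin M → Fin n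
    vertex f i = Fin.fromℕ< (vertex< i (choice f i))

    toℕ-vertex : ∀ f i → toℕ (vertex f i) ≡ toℕ i + toℕ (choice f i) * M
    toℕ-vertex f i = Fin.toℕ-fromℕ< (vertex< i (choice f i))

    level-vertex : ∀ f i → level (vertex f i) ≡ toℕ i
    level-vertex f i = trans (cong (_% M) (toℕ-vertex f i))
      (trans ([m+kn]%n≡m%n (toℕ i) (toℕ (choice f i)) M) (m<n⇒m%n≡m (Fin.toℕ<n i)))

    strand-vertex : ∀ f i → strand (vertex f i) ≡ toℕ (choice f i)
    strand-vertex f i = trans (cong (_/ M) (toℕ-vertex f i))
      (trans (+-distrib-/-∣ʳ (toℕ i) (n∣m*n (toℕ (choice f i))))
        (cong₂ _+_ (m<n⇒m/n≡0 (Fin.toℕ<n i)) (m*n/n≡m (toℕ (choice f i)) M)))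

    route : Vec (Fin t) m → Vec (Fin n) M
    route f = Vec.tabulate (vertex f)

    lookup-route : ∀ f i → Vec.lookup (route f) i ≡ vertex f i
    lookup-route f = Vec.lookup∘tabulate (vertex f)

    vertex-level-injective : ∀ f g i j → vertex f i ≡ vertex g j → i ≡ j
    vertex-level-injective f g i j eq = Fin.toℕ-injective
      (trans (sym (level-vertex f i)) (trans (cong level eq) (level-vertex g j)))

    route-injective : ∀ f → Injective (route f)
    route-injective f i j eq = vertex-level-injective f f i j
      (trans (sym (lookup-route f i)) (trans eq (lookup-route f j)))

    vertex-valid : ∀ f i → Valid (vertex f i)
    vertex-valid f i h = trans (strand-vertex f i) (choice-hub f i (subst (l ∣_) (level-vertex f i) h))

    vertex-step : ∀ f i j → Next i j → U (vertex f i) (vertex f j)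
    vertex-step f i j next = (vertex-valid f i , vertex-valid f j) ,
      trans (cong (λ r → suc r % M) (level-vertex f i)) (trans (levels next) (sym (level-vertex f j))) ,
      strands next (l ∣? toℕ i) (l ∣? toℕ j)
      where
      levels : Next i j → suc (toℕ i) % M ≡ toℕ j
      levels (inj₁ eq) = trans (cong (_% M) eq) (m<n⇒m%n≡m (Fin.toℕ<n j))
      levels (inj₂ (eq , j≡0)) = trans (cong (_% M) eq) (trans (n%n≡0 M) (sym j≡0))
      strands : Next i j → Dec (l ∣ toℕ i) → Dec (l ∣ toℕ j) →
        strand (vertex f i) ≡ strand (vertex f j) ⊎ (Hub (vertex f i) ⊎ Hub (vertex f j))
      strands _ (yes h) _ = inj₂ (inj₁ (subst (l ∣_) (sym (level-vertex f i)) h))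
      strands _ _ (yes h) = inj₂ (inj₂ (subst (l ∣_) (sym (level-vertex f j)) h))
      strands (inj₂ (_ , j≡0)) _ (no ¬h) = contradiction (subst (l ∣_) (sym j≡0) (l ∣0)) ¬h
      strands (inj₁ eq) (no ¬hi) (no ¬hj) = inj₁ (trans (strand-vertex f i)
        (trans (cong toℕ (trans (choice-inner f i q ¬hi (sym (Fin.toℕ-fromℕ< (index<m i))))
            (sym (choice-inner f j q ¬hj (trans (trans (cong (_/ l) (sym eq)) (suc-/ (toℕ i) l (¬hj ∘ subst (l ∣_) eq)))
              (sym (Fin.toℕ-fromℕ< (index<m i))))))))
          (sym (strand-vertex f j))))
        where q = Fin.fromℕ< (index<m i)

    route-hom : ∀ f i j → Adj (C M) i j → Adj ladder (Vec.lookup (route f) i) (Vec.lookup (route f) j)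
    route-hom f i j ij = subst₂ (Adj ladder) (sym (lookup-route f i)) (sym (lookup-route f j))
      (∈-matrix⁺ edge? (edge (proj₂ (C-adj⁻ {k = M} {i} {j} ij))))
      where
      edge : Next i j ⊎ Next j i → U (vertex f i) (vertex f j) ⊎ U (vertex f j) (vertex f i)
      edge (inj₁ next) = inj₁ (vertex-step f i j next)
      edge (inj₂ next) = inj₂ (vertex-step f j i next)

    copy : Vec (Fin t) m → Sub n
    copy f = Image.image (C M) (route f) (route-injective f)

    -- The choice in gap `q` can be read off on level `1 + q * l`, which is not a hub level because
    -- `2 ≤ l`. A route has exactly one vertex on each level, so equal vertex sets force equal
    -- strands there.
    copy-injective : ∀ {f g} → copy f ≡ copy g → f ≡ g
    copy-injective {f} {g} eq = vec-ext same
      where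
      same : ∀ q → Vec.lookup f q ≡ Vec.lookup g q
      same q = via (image-⊆ (C M) (route f) (route g) (route-injective f) (route-injective g) eq i)
        where
        i<M : 1 + toℕ q * l < M
        i<M = ℕ.<-≤-trans (ℕ.+-monoˡ-< (toℕ q * l) 2≤l) (ℕ.*-monoˡ-≤ l (Fin.toℕ<n q))
        i : Fin M
        i = Fin.fromℕ< i<M
        toℕ-i : toℕ i ≡ 1 + toℕ q * l
        toℕ-i = Fin.toℕ-fromℕ< i<M
        ¬hub : ¬ (l ∣ toℕ i)
        ¬hub h = ℕ.<⇒≱ 2≤l (∣⇒≤ (∣m+n∣m⇒∣n
          (subst (l ∣_) (trans toℕ-i (ℕ.+-comm 1 (toℕ q * l))) h) (n∣m*n (toℕ q))))
        index : toℕ i / l ≡ toℕ q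
        index = trans (cong (_/ l) toℕ-i) (trans (+-distrib-/-∣ʳ 1 (n∣m*n (toℕ q)))
          (cong₂ _+_ (m<n⇒m/n≡0 2≤l) (m*n/n≡m (toℕ q) l)))
        via : (∃ λ j → Vec.lookup (route g) j ≡ Vec.lookup (route f) i) → Vec.lookup f q ≡ Vec.lookup g q
        via (j , e) = trans (sym (choice-inner f i q ¬hub index)) (trans
          (Fin.toℕ-injective (trans (sym (strand-vertex f i)) (trans (cong strand (sym e″)) (strand-vertex g i))))
          (choice-inner g i q ¬hub index))
          where
          e′ : vertex g j ≡ vertex f i
          e′ = trans (sym (lookup-route g j)) (trans e (lookup-route f i))
          e″ : vertex g i ≡ vertex f i
          e″ = subst (λ j → vertex g j ≡ vertex f i) (vertex-level-injective g f j i e′) e′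

    #copies-ladder : t ^ m ≤ #copies (C M) ladder
    #copies-ladder = subst (_≤ #copies (C M) ladder) (length-vectors-allFin t m)
      (≤-#copies (C M) ladder copy copy-injective
        (λ f → Image.image-copy (C M) (route f) (route-injective f) ladder (route-hom f))
        (vectors-unique (Unique.allFin⁺ t) m))

-- Cycles in the ladder have length `m * l` or `2 * l`. Both are at least `2 * l`, and neither
-- equals `2 * k`: the first by hypothesis, the second because `l < k`.
ladder-free : ∀ n l k m (2≤l : 2 ≤ l) (2≤m : 2 ≤ m) .{{_ : NonZero l}} .{{_ : NonZero (m * l)}} →
  l < k → 2 * k ≢ m * l → Free (Forbidden l k) (LadderGraph.ladder n m l 2≤l 2≤m)
ladder-free n l k@(suc k′) m 2≤l 2≤m l<k 2k≢ml = All.tabulate λ H∈ → excluded (∈-++⁻ (cycles 3 (2 * l ∸ 1)) H∈)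
  where
  open LadderGraph n m l 2≤l 2≤m
  excluded : ∀ {H} → H ∈ cycles 3 (2 * l ∸ 1) ⊎ H ∈ [ 2 * k , C (2 * k) ] → ¬ Contains ladder (proj₂ H)
  excluded (inj₁ H∈) G⊇H with ∈-applyUpTo⁻ (λ i → 3 + i , C (3 + i)) H∈
  ... | i , i< , refl = [ ℕ.<⇒≢ (ℕ.<-≤-trans short 2l≤M) , ℕ.<⇒≢ short ]′
        (contains⇒length (2 + i) (s≤s (s≤s z≤n)) G⊇H)
    where
    short : 3 + i < 2 * l
    short = ℕ.≰⇒> λ 2l≤ → ℕ.<⇒≱ i< (ℕ.≤-trans (ℕ.≤-reflexive (ℕ.∸-+-assoc (2 * l) 1 2))
      (ℕ.m≤n+o⇒m∸n≤o (2 * l) 3 2l≤))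
  excluded (inj₂ (here refl)) G⊇H = [ 2k≢ml , (λ eq → ℕ.<⇒≢ l<k (sym (ℕ.*-cancelˡ-≡ k l 2 eq))) ]′
    (contains⇒length (k′ + (suc k′ + 0)) (ℕ.≤-trans (ℕ.≤-trans 2≤l (s≤s⁻¹ l<k)) (ℕ.m≤m+n k′ _)) G⊇H)

lower-bound : ∀ l k m → 2 ≤ l → 2 ≤ m → .{{_ : NonZero l}} .{{_ : NonZero (m * l)}} →
  l < k → 2 * k ≢ m * l →
  (λ n → n ^ m) =O (λ n → ex n (C (m * l)) (Forbidden l k))
-- With `t = n / M`, the constant comes from `n ≤ 2 * M * t`: the remainder is below `M`, and
-- `M ≤ t * M` once `n` is at least `M`.
lower-bound l k m 2≤l 2≤m l<k 2k≢ml = (2 * M) ^ m , M , bound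
  where
  M = m * l
  bound : ∀ n → M ≤ n → n ^ m ≤ (2 * M) ^ m * ex n (C M) (Forbidden l k)
  bound n M≤n = begin
    n ^ m                                    ≤⟨ ℕ.^-monoˡ-≤ m n≤2Mt ⟩
    (2 * M * t) ^ m                          ≡⟨ ^-distrib-* (2 * M) t m ⟩
    (2 * M) ^ m * t ^ m                      ≤⟨ ℕ.*-monoʳ-≤ ((2 * M) ^ m) (ℕ.≤-trans #copies-ladder ladder≤ex) ⟩
    (2 * M) ^ m * ex n (C M) (Forbidden l k) ∎
    where
    open ℕ.≤-Reasoning
    t = n / M
    0<t : 0 < t
    0<t = m≥n⇒m/n>0 M≤n
    open LadderGraph n m l 2≤l 2≤m using (ladder; module Strands)
    open Strands t 0<t (m/n*n≤m n M) using (#copies-ladder)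
    ladder≤ex : #copies (C M) ladder ≤ ex n (C M) (Forbidden l k)
    ladder≤ex = ≤-ex {H = C M} {Forbidden l k} ladder (ladder-free n l k m 2≤l 2≤m l<k 2k≢ml)
    n≤2Mt : n ≤ 2 * M * t
    n≤2Mt = begin
      n                 ≡⟨ m≡m%n+[m/n]*n n M ⟩
      n % M + t * M     ≤⟨ ℕ.+-monoˡ-≤ (t * M) (ℕ.<⇒≤ (m%n<n n M)) ⟩
      M + t * M         ≤⟨ ℕ.+-monoˡ-≤ (t * M) (ℕ.≤-trans (ℕ.≤-reflexive (sym (ℕ.*-identityˡ M))) (ℕ.*-monoˡ-≤ M 0<t)) ⟩
      t * M + t * M     ≡⟨ solve 2 (λ t M → t :* M :+ t :* M := con 2 :* M :* t) refl t M ⟩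
      2 * M * t         ∎

-- The two bounds in terms of `l`, `k` and `m`

upper-bound : ∀ l k m {h′ e m′} → l ≡ suc (suc h′) → k ≡ l + e → m ≡ suc (suc m′) →
  (λ n → ex n (C (m * l)) (Forbidden l k)) =O (λ n → n ^ m)
upper-bound l k m {h′} {e} {m′} l≡ refl m≡ = K₀ , 0 , λ n _ →
  subst₂ (λ l m → ex n (C N) (Forbidden l (l + e)) ≤ K₀ * n ^ m) (sym l≡) (sym m≡) (ex-bound n)
  where
  N = m * l
  open UpperBound h′ e m′ N (cong₂ _*_ m≡ l≡)

theorem11 : (l k m : ℕ) → 2 ≤ l → l < k → 2 ≤ m → 2 * k ≢ m * l →
    (λ n → ex n (C (m * l)) (cycles 3 (2 * l ∸ 1) ++ [ 2 * k , C (2 * k) ])) =Θ (λ n → n ^ m)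
theorem11 l k m 2≤l l<k 2≤m 2k≢ml =
  upper-bound l k m (sym (ℕ.m+[n∸m]≡n 2≤l)) (sym (ℕ.m+[n∸m]≡n (ℕ.<⇒≤ l<k))) (sym (ℕ.m+[n∸m]≡n 2≤m)) ,
  lower-bound l k m 2≤l 2≤m {{l≢0}} {{ℕ.m*n≢0 m l {{m≢0}} {{l≢0}}}} l<k 2k≢ml
  where
  l≢0 : NonZero l
  l≢0 = >-nonZero (ℕ.≤-trans (s≤s z≤n) 2≤l)
  m≢0 : NonZero m
  m≢0 = >-nonZero (ℕ.≤-trans (s≤s z≤n) 2≤m)
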